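{- Let $p>0$ and $m,n>\max(p+1,2)$ be integers. Then \begin{align*} \zeta_{G_{m,n,p}}(u)^{ -1}=&-4u^{2m+2n-2p}+u^{2m+2n-4p}+2u^{m+2n-2p}+2u^{2m+n-2p}\\ &+u^{2n}+u^{2m}+2u^{m+n}-2u^{m+n-2p}-2u^{n}-2u^{m}+1. \end{align*}
   Context: For integers $p>0$ and $m,n>\max(p+1,2)$, $G_{m,n,p}$ is the graph obtained from a cycle $C_m$ and a cycle $C_n$ by identifying a path of $p$ consecutive edges of $C_m$ with a path of $p$ consecutive edges of $C_n$; equivalently, it consists of two distinct vertices joined by three internally disjoint paths of lengths $p$, $m-p$ and $n-p$. It has $m+n-p-1$ vertices and $m+n-p$ edges. For a finite connected graph $G$ with vertex set $V$, edge set $E$ and no vertex of degree $1$, let $r=|E|-|V|+1$, $\mathcal{A}$ the adjacency matrix, $\mathcal{Q}=D-I$ with $D$ the diagonal degree matrix; the reciprocal Ihara zeta function is $\zeta_G(u)^{ -1}=(1-u^2)^{r-1}\det(I-\mathcal{A}u+\mathcal{Q}u^2)$. -}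

module Defs where

open import Algebra.Bundles using (CommutativeRing)
import Algebra.Properties.Semiring.Exp as Exp
import Algebra.Properties.Semiring.Mult as Mult
import Algebra.Properties.Semiring.Sum as Sums
open import Data.Bool.Base using (if_then_else_)
open import Data.Fin.Base as Fin using (Fin; toℕ; fromℕ<; punchIn)
open import Data.Fin.Properties as Fin using (toℕ<n; toℕ-fromℕ<; toℕ-injective; any?)
open import Data.List.Base using (length; filter; allFin; cartesianProduct)
open import Data.Nat.Base as ℕ using (ℕ; zero; suc; _∸_; _⊔_; _≤_; _<_; s≤s)
open import Data.Nat.Properties as ℕ hiding (_≟_)
open import Data.Product.Base using (∃₂; _×_; _,_)
open import Data.Sum.Base as Sum using (_⊎_; inj₁; inj₂; swap)
open import Function.Definitions using (Injective)
open import Level using (0ℓ)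
open import Relation.Binary.Core using (Rel)
open import Relation.Binary.Definitions using (Decidable; Symmetric)
open import Relation.Binary.PropositionalEquality as ≡ using (_≡_; trans; cong; subst; module ≡-Reasoning)
open import Relation.Nullary using (¬_; yes; no; does; contradiction)
open import Relation.Nullary.Decidable using (_×-dec_; _⊎-dec_)

record Graph : Set₁ where
  field
    order  : ℕ
    Adj    : Rel (Fin order) 0ℓ
    adj?   : Decidable Adj
    sym    : Symmetric Adj
    irrefl : ∀ x → ¬ Adj x x

  degree : Fin order → ℕ
  degree x = length (filter (adj? x) (allFin order))

  -- Each edge is counted once, at its ordered pair of endpoints i < j.
  size : ℕ
  size = length (filter (λ (i , j) → (i Fin.<? j) ×-dec adj? i j)
                        (cartesianProduct (allFin order) (allFin order)))

  -- |E| - |V| + 1; the subtraction is exact for connected graphs.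
  rank : ℕ
  rank = (size ℕ.+ 1) ∸ order

-- j = i + 1 modulo k
Next : ∀ {k} → Rel (Fin k) 0ℓ
Next {k} i j = (toℕ j ≡ suc (toℕ i)) ⊎ (suc (toℕ i) ≡ k × toℕ j ≡ 0)

next? : ∀ {k} → Decidable (Next {k})
next? {k} i j = (toℕ j ℕ.≟ suc (toℕ i)) ⊎-dec ((suc (toℕ i) ℕ.≟ k) ×-dec (toℕ j ℕ.≟ 0))

next-irrefl : ∀ {k} → 2 < k → (i : Fin k) → ¬ Next i i
next-irrefl 2<k i (inj₁ e)       = 1+n≢n (≡.sym e)
next-irrefl 2<k i (inj₂ (e , z)) with subst (2 <_) (trans (≡.sym e) (cong suc z)) 2<k
... | s≤s ()

cycle : ∀ k → 2 < k → Graph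
cycle k 2<k = record
  { order  = k
  ; Adj    = λ i j → Next i j ⊎ Next j i
  ; adj?   = λ i j → next? i j ⊎-dec next? j i
  ; sym    = swap
  ; irrefl = λ i → Sum.[ next-irrefl 2<k i , next-irrefl 2<k i ]
  }

-- C_m and C_n glued along the path 0 - 1 - ... - p that both contain.
-- The quotient vertex set is numbered so that C_m keeps its labels and the
-- vertices p + 1, ..., n - 1 of C_n become m, ..., m + n - p - 2.
module Glue (m n p : ℕ) (m> : (p ℕ.+ 1) ⊔ 2 < m) (n> : (p ℕ.+ 1) ⊔ 2 < n) where

  Cₘ Cₙ : Graph
  Cₘ = cycle m (m⊔n<o⇒n<o (p ℕ.+ 1) 2 m>)
  Cₙ = cycle n (m⊔n<o⇒n<o (p ℕ.+ 1) 2 n>)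

  order : ℕ
  order = m ℕ.+ n ∸ p ∸ 1

  p<m : p < m
  p<m = <-trans (subst (p <_) (ℕ.+-comm 1 p) ≤-refl) (m⊔n<o⇒m<o (p ℕ.+ 1) 2 m>)

  p<n : p < n
  p<n = <-trans (subst (p <_) (ℕ.+-comm 1 p) ≤-refl) (m⊔n<o⇒m<o (p ℕ.+ 1) 2 n>)

  order≡ : order ≡ m ℕ.+ (n ∸ suc p)
  order≡ = begin
    m ℕ.+ n ∸ p ∸ 1      ≡⟨ ∸-+-assoc (m ℕ.+ n) p 1 ⟩
    m ℕ.+ n ∸ (p ℕ.+ 1)  ≡⟨ cong (m ℕ.+ n ∸_) (ℕ.+-comm p 1) ⟩
    m ℕ.+ n ∸ suc p      ≡⟨ +-∸-assoc m p<n ⟩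
    m ℕ.+ (n ∸ suc p)    ∎
    where open ≡-Reasoning

  m≤order : m ≤ order
  m≤order = subst (m ≤_) (≡.sym order≡) (m≤m+n m _)

  relabel : ℕ → ℕ
  relabel j with j ℕ.≤? p
  ... | yes _ = j
  ... | no  _ = m ℕ.+ (j ∸ suc p)

  relabel< : ∀ {j} → j < n → relabel j < order
  relabel< {j} j<n with j ℕ.≤? p
  ... | yes j≤p = <-≤-trans (≤-<-trans j≤p p<m) m≤order
  ... | no  j≰p = subst (m ℕ.+ (j ∸ suc p) <_) (≡.sym order≡)
                    (ℕ.+-monoʳ-< m (∸-monoˡ-< j<n (≰⇒> j≰p)))

  relabel-injective : Injective _≡_ _≡_ relabel
  relabel-injective {i} {j} e with i ℕ.≤? p | j ℕ.≤? p
  ... | yes _   | yes _   = e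
  ... | yes i≤p | no _    = contradiction (subst (m ≤_) (≡.sym e) (m≤m+n m _))
                                          (<⇒≱ (≤-<-trans i≤p p<m))
  ... | no _    | yes j≤p = contradiction (subst (m ≤_) e (m≤m+n m _))
                                          (<⇒≱ (≤-<-trans j≤p p<m))
  ... | no i≰p  | no j≰p  = ∸-cancelʳ-≡ (≰⇒> i≰p) (≰⇒> j≰p) (ℕ.+-cancelˡ-≡ m _ _ e)

  ιₘ : Fin m → Fin order
  ιₘ i = fromℕ< (<-≤-trans (toℕ<n i) m≤order)

  ιₙ : Fin n → Fin order
  ιₙ j = fromℕ< (relabel< (toℕ<n j))

  ιₘ-injective : Injective _≡_ _≡_ ιₘ
  ιₘ-injective e = toℕ-injective
    (trans (≡.sym (toℕ-fromℕ< _)) (trans (cong toℕ e) (toℕ-fromℕ< _)))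

  ιₙ-injective : Injective _≡_ _≡_ ιₙ
  ιₙ-injective e = toℕ-injective (relabel-injective
    (trans (≡.sym (toℕ-fromℕ< _)) (trans (cong toℕ e) (toℕ-fromℕ< _))))

  Image : (C : Graph) → (Fin (Graph.order C) → Fin order) → Rel (Fin order) 0ℓ
  Image C ι x y = ∃₂ λ i j → Graph.Adj C i j × (ι i ≡ x × ι j ≡ y)

  image? : ∀ C ι → Decidable (Image C ι)
  image? C ι x y = any? λ i → any? λ j →
    Graph.adj? C i j ×-dec ((ι i Fin.≟ x) ×-dec (ι j Fin.≟ y))

  image-sym : ∀ C ι → Symmetric (Image C ι)
  image-sym C ι (i , j , a , e , f) = j , i , Graph.sym C a , f , e

  image-irrefl : ∀ C ι → Injective _≡_ _≡_ ι → ∀ x → ¬ Image C ι x x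
  image-irrefl C ι inj x (i , j , a , e , f) =
    Graph.irrefl C j (subst (λ k → Graph.Adj C k j) (inj (trans e (≡.sym f))) a)

  graph : Graph
  graph = record
    { order  = order
    ; Adj    = λ x y → Image Cₘ ιₘ x y ⊎ Image Cₙ ιₙ x y
    ; adj?   = λ x y → image? Cₘ ιₘ x y ⊎-dec image? Cₙ ιₙ x y
    ; sym    = Sum.map (image-sym Cₘ ιₘ) (image-sym Cₙ ιₙ)
    ; irrefl = λ x → Sum.[ image-irrefl Cₘ ιₘ ιₘ-injective x
                         , image-irrefl Cₙ ιₙ ιₙ-injective x ]
    }

G : ∀ m n p → (p ℕ.+ 1) ⊔ 2 < m → (p ℕ.+ 1) ⊔ 2 < n → Graph
G = Glue.graph

module Zeta {c ℓ} (R : CommutativeRing c ℓ) where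

  open CommutativeRing R hiding (zero; sym)
  open Exp semiring using (_^_)
  open Mult semiring using () renaming (_×_ to _·_)
  open Sums semiring using (sum)

  Matrix : ℕ → Set c
  Matrix k = Fin k → Fin k → Carrier

  -- Laplace expansion along the first row.
  det : ∀ {k} → Matrix k → Carrier
  det {zero}  M = 1#
  det {suc k} M = sum λ j →
    (- 1#) ^ toℕ j * (M Fin.zero j * det λ a b → M (Fin.suc a) (punchIn j b))

  diagonal : ∀ {k} → (Fin k → Carrier) → Matrix k
  diagonal d i j = if does (i Fin.≟ j) then d i else 0#

  module _ (H : Graph) where
    open Graph H using (order; adj?; degree; rank)

    I 𝓐 D 𝓠 : Matrix order
    I = diagonal λ _ → 1#
    𝓐 i j = if does (adj? i j) then 1# else 0#
    D = diagonal λ i → degree i · 1#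
    𝓠 i j = D i j - I i j

    -- The truncated exponent rank ∸ 1 is exact whenever the graph contains a
    -- cycle; a connected graph without vertices of degree 1 does, unless it is
    -- a single vertex.
    ζ⁻¹ : Carrier → Carrier
    ζ⁻¹ u = (1# - u ^ 2) ^ (rank ∸ 1)
          * det (λ i j → I i j - 𝓐 i j * u + 𝓠 i j * u ^ 2)

{-# OPTIONS --safe #-}
module Submission where

-- Write U = I - u P, where P is the child-parent matrix of a spanning tree, a
-- unitriangular matrix. For any graph, I - 𝓐 u + 𝓠 u² = Uᵀ U + K, where K only
-- involves the root and the endpoints of the edges outside the tree. Hence the
-- determinant is that of I + K (Uᵀ U)⁻¹, whose rows are those of the identity
-- except at these vertices. For two cycles glued along a path the tree can be
-- chosen with three such vertices: both edges outside the tree end at the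
-- root. The entries of (Uᵀ U)⁻¹ are geometric sums of powers of u, and the
-- factor 1 - u² turns the resulting 3 × 3 determinant into the polynomial.
open import Algebra.Bundles using (CommutativeRing; RawRing; Semiring)
import Algebra.Properties.CommutativeSemigroup
import Algebra.Properties.Ring
import Algebra.Properties.Semiring.Exp
import Algebra.Properties.Semiring.Mult
import Algebra.Properties.Semiring.Sum
import Algebra.Solver.Ring
open import Algebra.Solver.Ring.AlmostCommutativeRing using (fromCommutativeRing; _-Raw-AlmostCommutative⟶_)
open import Data.Bool.Base using (true; false; if_then_else_)
open import Data.Empty using (⊥)
open import Data.Fin.Base as Fin using (Fin; zero; suc; toℕ; fromℕ<; punchIn; punchOut)
open import Data.Fin.Patterns using (0F; 1F; 2F)
open import Data.Fin.Properties as Fin using (_≟_; any?; toℕ<n; toℕ-fromℕ<; toℕ-injective; punchInᵢ≢i; punchIn-punchOut)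
open import Data.List.Base as List using (length; filter; tabulate; cartesianProduct)
open import Data.List.Properties using (length-++; filter-++)
open import Data.Maybe.Base using (Maybe; just; nothing)
open import Data.Nat.Base as ℕ using (ℕ; zero; suc; _<_; _≤_; z≤n; s≤s; _⊔_; _∸_)
import Data.Nat.Properties as ℕ
open import Data.Nat.Solver using (module +-*-Solver)
open import Data.Product.Base as Product using (∃; _,_)
open import Data.Sum.Base as Sum using (_⊎_; inj₁; inj₂; swap)
open import Function.Base using (_∘_; id)
open import Level using (0ℓ)
open import Relation.Binary.Definitions using (tri<; tri≈; tri>)
open import Relation.Binary.PropositionalEquality as ≡ using (_≡_; _≢_; cong; subst)
import Relation.Binary.Reasoning.Setoid
open import Relation.Nullary using (¬_; Dec; yes; no; does; contradiction)
open import Relation.Nullary.Decidable using (dec-true; dec-false; _⊎-dec_; _×-dec_)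
open import Relation.Unary using (Pred; Decidable)
open import Defs using (Graph; Next; G; module Glue; module Zeta)

-- The product Uᵀ U fits because every vertex has at most one parent: Pᵀ P is diagonal and counts
-- children. Off the root the parent accounts for the 1 subtracted in `𝓠`, so on the tree `𝓠` is
-- exactly this count; the root has no parent, which leaves a deficit of u² there. Each edge outside
-- the tree adds u² at both ends and -u at its two off-diagonal places. With two such edges at the
-- root, its diagonal entry in K is 2u² - u² = u², the same as at the other two ends. The ring and u
-- are arbitrary, which shapes the rest. As 1 - u² may be a zero divisor, a geometric sum has a
-- closed form only after multiplication by 1 - u²; rank 2 supplies one such factor, while the 3 × 3
-- determinant is quadratic in the sums. As 2 may be a zero divisor too, the vanishing of a
-- determinant with two equal columns cannot be drawn from antisymmetry and is proved first, from
-- the Laplace expansion. The inverse of Uᵀ U is given explicitly, as a Green function: its entry at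
-- two vertices is a sum over their common ancestors, which obeys a recursion along the tree.

-- A difference a - b of natural numbers, kept unnormalised as a pair; unlike
-- the carrier of R these have a decidable equality, which lets the ring
-- solver cancel.
Difference : RawRing 0ℓ 0ℓ
Difference = record
  { Carrier = ℕ Product.× ℕ
  ; _≈_     = _≡_
  ; _+_     = λ (a , b) (c , d) → a ℕ.+ c , b ℕ.+ d
  ; _*_     = λ (a , b) (c , d) → a ℕ.* c ℕ.+ b ℕ.* d , a ℕ.* d ℕ.+ b ℕ.* c
  ; -_      = λ (a , b) → b , a
  ; 0#      = 0 , 0
  ; 1#      = 1 , 0
  }

-- Polynomial identities with integer coefficients.

module RingSolver {c ℓ} (R : CommutativeRing c ℓ) where
  open CommutativeRing R hiding (zero)
  open Algebra.Properties.Ring ring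
  open Algebra.Properties.Semiring.Mult semiring using (×-homo-+; ×1-homo-*; ×-congˡ) renaming (_×_ to infixr 8 _·_)
  open Algebra.Properties.CommutativeSemigroup +-commutativeSemigroup using () renaming (interchange to +-interchange)
  open Relation.Binary.Reasoning.Setoid setoid

  -- Reduced differences make equal coefficients evaluate to identical terms,
  -- and the clauses for 0 and 1 give 0# and 1# on the nose.
  _⊝_ : ℕ → ℕ → Carrier
  suc a       ⊝ suc b = a ⊝ b
  zero        ⊝ zero  = 0#
  suc zero    ⊝ zero  = 1#
  suc (suc a) ⊝ zero  = suc (suc a) · 1#
  zero        ⊝ suc b = - (suc b · 1#)

  private
    interchange : ∀ a b c d → (a + c) - (b + d) ≈ (a - b) + (c - d)
    interchange a b c d = begin
      (a + c) - (b + d)      ≈⟨ +-congˡ (-‿+-comm b d) ⟨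
      (a + c) + (- b + - d)  ≈⟨ +-interchange a c (- b) (- d) ⟩
      (a - b) + (c - d)      ∎

    product : ∀ a b c d → (a * c + b * d) - (a * d + b * c) ≈ (a - b) * (c - d)
    product a b c d = begin
      (a * c + b * d) - (a * d + b * c)    ≈⟨ interchange _ _ _ _ ⟩
      (a * c - a * d) + (b * d - b * c)    ≈⟨ +-congˡ (⁻¹-anti-homo‿- _ _) ⟨
      (a * c - a * d) - (b * c - b * d)    ≈⟨ +-cong (x[y-z]≈xy-xz a c d) (-‿cong (x[y-z]≈xy-xz b c d)) ⟨
      a * (c - d) - b * (c - d)            ≈⟨ [y-z]x≈yx-zx (c - d) a b ⟨
      (a - b) * (c - d)                    ∎

    ⊝≈- : ∀ a b → a ⊝ b ≈ a · 1# - b · 1#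
    ⊝≈- zero          zero    = sym (-‿inverseʳ 0#)
    ⊝≈- (suc zero)    zero    = sym (trans (+-cong (+-identityʳ 1#) -0#≈0#) (+-identityʳ 1#))
    ⊝≈- (suc (suc a)) zero    = sym (trans (+-congˡ -0#≈0#) (+-identityʳ _))
    ⊝≈- zero          (suc b) = sym (+-identityˡ _)
    ⊝≈- (suc a)       (suc b) = begin
      a ⊝ b                              ≈⟨ ⊝≈- a b ⟩
      a · 1# - b · 1#                    ≈⟨ +-identityˡ _ ⟨
      0# + (a · 1# - b · 1#)             ≈⟨ +-congʳ (-‿inverseʳ 1#) ⟨
      (1# - 1#) + (a · 1# - b · 1#)      ≈⟨ interchange _ _ _ _ ⟨
      (1# + a · 1#) - (1# + b · 1#)      ∎

    difference-homo : Difference -Raw-AlmostCommutative⟶ fromCommutativeRing R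
    difference-homo = record
      { ⟦_⟧    = λ (a , b) → a ⊝ b
      ; +-homo = λ (a , b) (c , d) → begin
          (a ℕ.+ c) ⊝ (b ℕ.+ d)                    ≈⟨ ⊝≈- (a ℕ.+ c) (b ℕ.+ d) ⟩
          (a ℕ.+ c) · 1# - (b ℕ.+ d) · 1#          ≈⟨ +-cong (×-homo-+ 1# a c) (-‿cong (×-homo-+ 1# b d)) ⟩
          (a · 1# + c · 1#) - (b · 1# + d · 1#)    ≈⟨ interchange _ _ _ _ ⟩
          (a · 1# - b · 1#) + (c · 1# - d · 1#)    ≈⟨ +-cong (⊝≈- a b) (⊝≈- c d) ⟨
          (a ⊝ b) + (c ⊝ d)                    ∎
      ; *-homo = λ (a , b) (c , d) → begin
          (a ℕ.* c ℕ.+ b ℕ.* d) ⊝ (a ℕ.* d ℕ.+ b ℕ.* c)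
            ≈⟨ ⊝≈- (a ℕ.* c ℕ.+ b ℕ.* d) (a ℕ.* d ℕ.+ b ℕ.* c) ⟩
          (a ℕ.* c ℕ.+ b ℕ.* d) · 1# - (a ℕ.* d ℕ.+ b ℕ.* c) · 1#
            ≈⟨ +-cong (×1-homo-*+* a c b d) (-‿cong (×1-homo-*+* a d b c)) ⟩
          (a · 1# * c · 1# + b · 1# * d · 1#) - (a · 1# * d · 1# + b · 1# * c · 1#)
            ≈⟨ product _ _ _ _ ⟩
          (a · 1# - b · 1#) * (c · 1# - d · 1#)
            ≈⟨ *-cong (⊝≈- a b) (⊝≈- c d) ⟨
          (a ⊝ b) * (c ⊝ d)  ∎
      ; -‿homo = λ (a , b) → begin
          (b ⊝ a)              ≈⟨ ⊝≈- b a ⟩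
          b · 1# - a · 1#        ≈⟨ ⁻¹-anti-homo‿- _ _ ⟨
          - (a · 1# - b · 1#)    ≈⟨ -‿cong (⊝≈- a b) ⟨
          - (a ⊝ b)            ∎
      ; 0-homo = refl
      ; 1-homo = refl
      }
      where
      ×1-homo-*+* : ∀ a c b d → (a ℕ.* c ℕ.+ b ℕ.* d) · 1# ≈ a · 1# * c · 1# + b · 1# * d · 1#
      ×1-homo-*+* a c b d = trans (×-homo-+ 1# (a ℕ.* c) (b ℕ.* d)) (+-cong (×1-homo-* a c) (×1-homo-* b d))

    -- Equality as integers implies equality in `R`, but not conversely in positive characteristic;
    -- hence `nothing` and not a refutation.
    difference-≟ : ((a , b) (c , d) : ℕ Product.× ℕ) → Maybe (a ⊝ b ≈ c ⊝ d)
    difference-≟ (a , b) (c , d) with a ℕ.+ d ℕ.≟ c ℕ.+ b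
    ... | no  _ = nothing
    ... | yes e = just (x∙y⁻¹≈ε⇒x≈y _ _ (begin
      (a ⊝ b) - (c ⊝ d)                  ≈⟨ +-cong (⊝≈- a b) (-‿cong (⊝≈- c d)) ⟩
      (a · 1# - b · 1#) - (c · 1# - d · 1#)  ≈⟨ +-congˡ (⁻¹-anti-homo‿- _ _) ⟩
      (a · 1# - b · 1#) + (d · 1# - c · 1#)  ≈⟨ interchange _ _ _ _ ⟨
      (a · 1# + d · 1#) - (b · 1# + c · 1#)
        ≈⟨ +-cong (×-homo-+ 1# a d) (-‿cong (trans (×-homo-+ 1# c b) (+-comm _ _))) ⟨
      (a ℕ.+ d) · 1# - (c ℕ.+ b) · 1#        ≈⟨ x≈y⇒x∙y⁻¹≈ε (×-congˡ e) ⟩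
      0#                                     ∎))

  open Algebra.Solver.Ring Difference (fromCommutativeRing R) difference-homo difference-≟ public
    using (Polynomial; con; solve; _:+_; _:*_; _:-_; :-_; _:×_; _:^_; _:=_)

  :0 :1 : ∀ {n} → Polynomial n
  :0 = con (0 , 0)
  :1 = con (1 , 0)

-- Finite sums with few nonzero terms.

module SumProperties {c ℓ} (S : Semiring c ℓ) where
  open Semiring S hiding (zero)
  open Algebra.Properties.Semiring.Sum S public
  open Relation.Binary.Reasoning.Setoid setoid

  sum-zero : ∀ {n} (f : Fin n → Carrier) → (∀ i → f i ≈ 0#) → sum f ≈ 0#
  sum-zero {n} f f≈0 = trans (sum-cong-≋ f≈0) (sum-replicate-zero n)

  sum-single : ∀ {n} {f : Fin n → Carrier} a → (∀ i → i ≢ a → f i ≈ 0#) → sum f ≈ f a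
  sum-single {suc n} {f} a f≈0 = begin
    sum f                             ≈⟨ sum-remove {i = a} f ⟩
    f a + sum (λ i → f (punchIn a i)) ≈⟨ +-congˡ (sum-zero _ λ i → f≈0 _ (punchInᵢ≢i a i)) ⟩
    f a + 0#                          ≈⟨ +-identityʳ _ ⟩
    f a                               ∎

  sum-pair : ∀ {n} {f : Fin n → Carrier} {a b} → a ≢ b →
             (∀ i → i ≢ a → i ≢ b → f i ≈ 0#) → sum f ≈ f a + f b
  sum-pair {suc n} {f} {a} {b} a≢b f≈0 = begin
    sum f                                 ≈⟨ sum-remove {i = a} f ⟩
    f a + sum (λ i → f (punchIn a i))     ≈⟨ +-congˡ (sum-single (punchOut a≢b) λ i i≢b′ →
                                               f≈0 _ (punchInᵢ≢i a i) (i≢b′ ∘ unpunch)) ⟩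
    f a + f (punchIn a (punchOut a≢b))    ≡⟨ cong (λ z → f a + f z) (punchIn-punchOut a≢b) ⟩
    f a + f b                             ∎
    where
    unpunch : ∀ {i} → punchIn a i ≡ b → i ≡ punchOut a≢b
    unpunch {i} e = Fin.punchIn-injective a i _ (≡.trans e (≡.sym (punchIn-punchOut a≢b)))

-- Determinants: linearity and alternation in the columns.

punchOut-adjacent : ∀ {n} {l a b : Fin (suc n)} (l≢a : l ≢ a) (l≢b : l ≢ b) →
                    toℕ b ≡ suc (toℕ a) → toℕ (punchOut l≢b) ≡ suc (toℕ (punchOut l≢a))
punchOut-adjacent {_}     {zero}  {zero}          l≢a l≢b e = contradiction ≡.refl l≢a
punchOut-adjacent {_}     {zero}  {suc a} {suc b} l≢a l≢b e = ℕ.suc-injective e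
punchOut-adjacent {suc _} {suc zero}    {zero} {suc zero} l≢a l≢b e = contradiction ≡.refl l≢b
punchOut-adjacent {suc (suc _)} {suc (suc l)} {zero} {suc zero} l≢a l≢b e = ≡.refl
punchOut-adjacent {suc _} {suc l} {suc a} {suc b} l≢a l≢b e =
  cong suc (punchOut-adjacent (l≢a ∘ cong suc) (l≢b ∘ cong suc) (ℕ.suc-injective e))

-- The lists of columns left after omitting `a` or `b` differ in one position at most, where each
-- contains the column that the other omits. If these two columns are equal, the minors coincide.
punchIn-adjacent : ∀ {n} {a b : Fin (suc n)} → toℕ b ≡ suc (toℕ a) → ∀ i →
                   punchIn a i ≡ punchIn b i ⊎ (punchIn a i ≡ b Product.× punchIn b i ≡ a)
punchIn-adjacent {_} {zero}  {suc zero} e zero    = inj₂ (≡.refl , ≡.refl)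
punchIn-adjacent {_} {zero}  {suc zero} e (suc i) = inj₁ ≡.refl
punchIn-adjacent {_} {suc a} {suc b}    e zero    = inj₁ ≡.refl
punchIn-adjacent {_} {suc a} {suc b}    e (suc i) with punchIn-adjacent (ℕ.suc-injective e) i
... | inj₁ p       = inj₁ (cong suc p)
... | inj₂ (p , q) = inj₂ (cong suc p , cong suc q)

module Determinant {c ℓ} (R : CommutativeRing c ℓ) where
  open CommutativeRing R hiding (zero)
  open Algebra.Properties.Ring ring
  open Algebra.Properties.Semiring.Exp semiring
  open SumProperties semiring
  open Zeta R using (Matrix; det; diagonal)
  open RingSolver R
  open Relation.Binary.Reasoning.Setoid setoid

  minor : ∀ {k} → Matrix (suc k) → Fin (suc k) → Matrix k
  minor M j a b = M (suc a) (punchIn j b)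

  cofactor : ∀ {k} → Matrix (suc k) → Fin (suc k) → Carrier
  cofactor M j = (- 1#) ^ toℕ j * (M zero j * det (minor M j))

  det-cong : ∀ {k} {M N : Matrix k} → (∀ i j → M i j ≈ N i j) → det M ≈ det N
  det-cong {zero}  M≈N = refl
  det-cong {suc k} M≈N = sum-cong-≋ λ j →
    *-congˡ {(- 1#) ^ toℕ j} (*-cong (M≈N zero j) (det-cong λ a b → M≈N (suc a) (punchIn j b)))

  private
    vanish : ∀ {k} (j : Fin k) {x} → x ≈ 0# → (- 1#) ^ toℕ j * x ≈ 0#
    vanish j x≈0 = trans (*-congˡ x≈0) (zeroʳ _)

  det-zero-row : ∀ {k} {M : Matrix k} i → (∀ j → M i j ≈ 0#) → det M ≈ 0#
  det-zero-row {suc k} {M} zero    M≈0 = sum-zero (cofactor M) λ j →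
    vanish j (trans (*-congʳ (M≈0 j)) (zeroˡ _))
  det-zero-row {suc k} {M} (suc i) M≈0 = sum-zero (cofactor M) λ j →
    vanish j (trans (*-congˡ {M zero j} (det-zero-row {M = minor M j} i λ b → M≈0 (punchIn j b))) (zeroʳ _))

  -- In the term of column `j` only the entry of the first row changes, since the minor omits that
  -- column; in every other term the minor is linear by induction. Pointwise hypotheses, rather than
  -- a column replacement, pass directly to minors.
  det-linear : ∀ {k} {A B C : Matrix k} j x → (∀ i → C i j ≈ A i j + x * B i j) →
               (∀ i l → l ≢ j → A i l ≈ C i l) → (∀ i l → l ≢ j → B i l ≈ C i l) →
               det C ≈ det A + x * det B
  det-linear {suc k} {A} {B} {C} j x C≈ A≈C B≈C = begin
    sum (cofactor C)                                    ≈⟨ sum-cong-≋ expand ⟩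
    sum (λ l → cofactor A l + x * cofactor B l)
      ≈⟨ ∑-distrib-+ (cofactor A) (λ l → x * cofactor B l) ⟩
    sum (cofactor A) + sum (λ l → x * cofactor B l)     ≈⟨ +-congˡ (*-distribˡ-sum x (cofactor B)) ⟨
    sum (cofactor A) + x * sum (cofactor B)             ∎
    where
    expand : ∀ l → cofactor C l ≈ cofactor A l + x * cofactor B l
    expand l with l ≟ j
    ... | yes ≡.refl = begin
      s * (C zero j * d)                                ≈⟨ *-congˡ (*-congʳ (C≈ zero)) ⟩
      s * ((A zero j + x * B zero j) * d)
        ≈⟨ solve 5 (λ s a x b d →
             s :* ((a :+ x :* b) :* d)
             := s :* (a :* d) :+ x :* (s :* (b :* d))) refl s _ x _ d ⟩
      s * (A zero j * d) + x * (s * (B zero j * d))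
        ≈⟨ +-cong (*-congˡ (*-congˡ (minor≈ A≈C))) (*-congˡ (*-congˡ (*-congˡ (minor≈ B≈C)))) ⟨
      cofactor A j + x * cofactor B j                   ∎
      where
      s = (- 1#) ^ toℕ j
      d = det (minor C j)
      minor≈ : ∀ {M} → (∀ i l → l ≢ j → M i l ≈ C i l) → det (minor M j) ≈ d
      minor≈ M≈C = det-cong λ a b → M≈C (suc a) (punchIn j b) (punchInᵢ≢i j b)
    ... | no l≢j = begin
      s * (C zero l * det (minor C l))                  ≈⟨ *-congˡ (*-congˡ IH) ⟩
      s * (C zero l * (det (minor A l) + x * det (minor B l)))
        ≈⟨ solve 5 (λ s c x a b →
             s :* (c :* (a :+ x :* b))
             := s :* (c :* a) :+ x :* (s :* (c :* b))) refl s _ x _ _ ⟩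
      s * (C zero l * det (minor A l)) + x * (s * (C zero l * det (minor B l)))
        ≈⟨ +-cong (*-congˡ (*-congʳ (A≈C zero l l≢j))) (*-congˡ (*-congˡ (*-congʳ (B≈C zero l l≢j)))) ⟨
      cofactor A l + x * cofactor B l                   ∎
      where
      s = (- 1#) ^ toℕ l
      punched : ∀ {b} → b ≢ punchOut l≢j → punchIn l b ≢ j
      punched b≢ e = b≢ (Fin.punchIn-injective l _ _ (≡.trans e (≡.sym (punchIn-punchOut l≢j))))
      IH : det (minor C l) ≈ det (minor A l) + x * det (minor B l)
      IH = det-linear (punchOut l≢j) x
        (λ i → subst (λ z → C (suc i) z ≈ A (suc i) z + x * B (suc i) z) (≡.sym (punchIn-punchOut l≢j)) (C≈ (suc i)))
        (λ i b b≢ → A≈C (suc i) _ (punched b≢)) (λ i b b≢ → B≈C (suc i) _ (punched b≢))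

  -- A zero column is its own double, so `det-linear` with `M` in all three roles makes the
  -- determinant equal to twice itself.
  det-zero-column : ∀ {k} {M : Matrix k} j → (∀ i → M i j ≈ 0#) → det M ≈ 0#
  det-zero-column {M = M} j M≈0 = +-identityʳ-unique (det M) (det M) (begin
    det M + det M         ≈⟨ +-congˡ (*-identityˡ _) ⟨
    det M + 1# * det M    ≈⟨ det-linear {A = M} {M} {M} j 1# doubled (λ _ _ _ → refl) (λ _ _ _ → refl) ⟨
    det M                 ∎)
    where
    doubled : ∀ i → M i j ≈ M i j + 1# * M i j
    doubled i = sym (trans (+-congˡ (trans (*-identityˡ _) (M≈0 i))) (+-identityʳ _))

  det-column-sum : ∀ {k n} {M : Matrix k} j (t : Fin n → Carrier) (V : Fin n → Matrix k) →
                   (∀ i → M i j ≈ sum (λ s → t s * V s i j)) →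
                   (∀ s i l → l ≢ j → V s i l ≈ M i l) →
                   det M ≈ sum (λ s → t s * det (V s))
  det-column-sum {n = zero}      j t V M≈ V≈M = det-zero-column j M≈
  det-column-sum {k} {suc n} {M} j t V M≈ V≈M = begin
    det M
      ≈⟨ det-linear j (t zero) split rest≈M (V≈M zero) ⟩
    det rest + t zero * det (V zero)                             ≈⟨ +-comm _ _ ⟩
    t zero * det (V zero) + det rest
      ≈⟨ +-congˡ (det-column-sum j (t ∘ suc) (V ∘ suc) rest-j rest-l) ⟩
    t zero * det (V zero) + sum (λ s → t (suc s) * det (V (suc s)))  ∎
    where
    rest : Matrix k
    rest i l = if does (l ≟ j) then sum (λ s → t (suc s) * V (suc s) i j) else M i l
    rest-j : ∀ i → rest i j ≈ sum (λ s → t (suc s) * V (suc s) i j)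
    rest-j i rewrite dec-true (j ≟ j) ≡.refl = refl
    rest≈M : ∀ i l → l ≢ j → rest i l ≈ M i l
    rest≈M i l l≢j rewrite dec-false (l ≟ j) l≢j = refl
    rest-l : ∀ s i l → l ≢ j → V (suc s) i l ≈ rest i l
    rest-l s i l l≢j = trans (V≈M (suc s) i l l≢j) (sym (rest≈M i l l≢j))
    split : ∀ i → M i j ≈ rest i j + t zero * V zero i j
    split i = trans (M≈ i) (trans (+-comm _ _) (+-congʳ (sym (rest-j i))))

  -- Quantified over all matrices because the induction on the distance between the columns applies
  -- it to a matrix with permuted columns.
  Alternating : ∀ {k} → Fin k → Fin k → Set _
  Alternating {k} a b = {M : Matrix k} → (∀ i → M i a ≈ M i b) → det M ≈ 0#

  -- A minor that omits a third column still has two equal adjacent columns and vanishes by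
  -- induction. The two remaining terms have equal entries and equal minors, and opposite signs
  -- because the columns are adjacent.
  alternating-adjacent : ∀ {k} {a b : Fin k} → toℕ b ≡ suc (toℕ a) → Alternating a b
  alternating-adjacent {suc k} {a} {b} b≡1+a {M} Ma≈Mb = begin
    sum (cofactor M)            ≈⟨ sum-pair a≢b others ⟩
    cofactor M a + cofactor M b ≈⟨ +-congˡ (begin
      (- 1#) ^ toℕ b * (M zero b * det (minor M b))
        ≡⟨ cong (λ z → (- 1#) ^ z * (M zero b * det (minor M b))) b≡1+a ⟩
      - 1# * (- 1#) ^ toℕ a * (M zero b * det (minor M b))  ≈⟨ *-assoc _ _ _ ⟩
      - 1# * ((- 1#) ^ toℕ a * (M zero b * det (minor M b))) ≈⟨ -1*x≈-x _ ⟩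
      - ((- 1#) ^ toℕ a * (M zero b * det (minor M b)))
        ≈⟨ -‿cong (*-congˡ (*-cong (Ma≈Mb zero) minors)) ⟨
      - cofactor M a                                        ∎) ⟩
    cofactor M a - cofactor M a ≈⟨ -‿inverseʳ _ ⟩
    0#                          ∎
    where
    a≢b : a ≢ b
    a≢b ≡.refl = ℕ.1+n≢n (≡.sym b≡1+a)
    minors : det (minor M a) ≈ det (minor M b)
    minors = det-cong λ i l → entry (suc i) l (punchIn-adjacent b≡1+a l)
      where
      entry : ∀ i l → punchIn a l ≡ punchIn b l ⊎ (punchIn a l ≡ b Product.× punchIn b l ≡ a) →
              M i (punchIn a l) ≈ M i (punchIn b l)
      entry i l (inj₁ e)       = reflexive (cong (M i) e)
      entry i l (inj₂ (e , f)) = trans (reflexive (cong (M i) e))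
        (trans (sym (Ma≈Mb i)) (reflexive (cong (M i) (≡.sym f))))
    others : ∀ l → l ≢ a → l ≢ b → cofactor M l ≈ 0#
    others l l≢a l≢b = vanish l (trans (*-congˡ {M zero l} IH) (zeroʳ _))
      where
      IH : det (minor M l) ≈ 0#
      IH = alternating-adjacent (punchOut-adjacent l≢a l≢b b≡1+a) λ i →
        trans (reflexive (cong (M (suc i)) (punchIn-punchOut l≢a)))
          (trans (Ma≈Mb (suc i)) (reflexive (cong (M (suc i)) (≡.sym (punchIn-punchOut l≢b)))))

  column : ∀ {k} → Matrix k → Fin k → Fin k → Carrier
  column M j i = M i j

  infixl 10 _[_≔_]
  _[_≔_] : ∀ {k} → Matrix k → Fin k → (Fin k → Carrier) → Matrix k
  (M [ j ≔ v ]) i l = if does (l ≟ j) then v i else M i l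

  [≔]-same : ∀ {k} (M : Matrix k) j v i → (M [ j ≔ v ]) i j ≈ v i
  [≔]-same M j v i rewrite dec-true (j ≟ j) ≡.refl = refl

  [≔]-other : ∀ {k} (M : Matrix k) j v i {l} → l ≢ j → (M [ j ≔ v ]) i l ≈ M i l
  [≔]-other M j v i {l} l≢j rewrite dec-false (l ≟ j) l≢j = refl

  -- Polarisation: with the sum `v` of both columns in both positions the determinant is zero.
  -- Linearity in column `a` splits it into `M` and `N`, each with `v` in column `b`; there the
  -- summand that repeats column `a` contributes nothing. Alternation is assumed for this pair only,
  -- so that the lemma is available inside the induction below.
  det-swap : ∀ {k} {M N : Matrix k} {a b} → a ≢ b → Alternating a b →
             (∀ i → M i a ≈ N i b) → (∀ i → M i b ≈ N i a) →
             (∀ i l → l ≢ a → l ≢ b → M i l ≈ N i l) → det M ≈ - det N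
  det-swap {k} {M} {N} {a} {b} a≢b alt Ma≈Nb Mb≈Na M≈N = +-inverseˡ-unique _ _ (begin
    det M + det N
      ≈⟨ +-cong (absorb M λ i → +-comm _ _) (absorb N λ i → +-cong (Ma≈Nb i) (Mb≈Na i)) ⟨
    det (M [ b ≔ v ]) + det (N [ b ≔ v ])      ≈⟨ +-congˡ (*-identityˡ _) ⟨
    det (M [ b ≔ v ]) + 1# * det (N [ b ≔ v ]) ≈⟨ det-linear a 1# column-a M-other N-other ⟨
    det (M [ a ≔ v ] [ b ≔ v ])
      ≈⟨ alt (λ i → trans (Q-a i) (sym ([≔]-same (M [ a ≔ v ]) b v i))) ⟩
    0#                                         ∎)
    where
    v : Fin k → Carrier
    v i = M i a + M i b
    absorb : ∀ X → (∀ i → v i ≈ X i b + X i a) → det (X [ b ≔ v ]) ≈ det X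
    absorb X v≈ = begin
      det (X [ b ≔ v ])
        ≈⟨ det-linear b 1# column-b
             (λ i l l≢b → sym ([≔]-other X b v i l≢b))
             (λ i l l≢b → trans ([≔]-other X b (column X a) i l≢b) (sym ([≔]-other X b v i l≢b))) ⟩
      det X + 1# * det (X [ b ≔ column X a ])
        ≈⟨ +-congˡ (*-congˡ (alt λ i → trans ([≔]-other X b (column X a) i a≢b) (sym ([≔]-same X b (column X a) i)))) ⟩
      det X + 1# * 0#                              ≈⟨ trans (+-congˡ (zeroʳ 1#)) (+-identityʳ _) ⟩
      det X                                        ∎
      where
      column-b : ∀ i → (X [ b ≔ v ]) i b ≈ X i b + 1# * (X [ b ≔ column X a ]) i b
      column-b i = trans ([≔]-same X b v i) (trans (v≈ i)
        (+-congˡ (sym (trans (*-identityˡ _) ([≔]-same X b (column X a) i)))))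
    Q-a : ∀ i → (M [ a ≔ v ] [ b ≔ v ]) i a ≈ v i
    Q-a i = trans ([≔]-other (M [ a ≔ v ]) b v i a≢b) ([≔]-same M a v i)
    column-a : ∀ i → (M [ a ≔ v ] [ b ≔ v ]) i a ≈ (M [ b ≔ v ]) i a + 1# * (N [ b ≔ v ]) i a
    column-a i = trans (Q-a i) (sym (+-cong ([≔]-other M b v i a≢b)
      (trans (*-identityˡ _) (trans ([≔]-other N b v i a≢b) (sym (Mb≈Na i))))))
    M-other : ∀ i l → l ≢ a → (M [ b ≔ v ]) i l ≈ (M [ a ≔ v ] [ b ≔ v ]) i l
    M-other i l l≢a with does (l ≟ b)
    ... | true  = refl
    ... | false = sym ([≔]-other M a v i l≢a)
    N-other : ∀ i l → l ≢ a → (N [ b ≔ v ]) i l ≈ (M [ a ≔ v ] [ b ≔ v ]) i l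
    N-other i l l≢a with l ≟ b
    ... | yes _  = refl
    ... | no l≢b = trans (sym (M≈N i l l≢a l≢b)) (sym ([≔]-other M a v i l≢a))

  -- Here `d` is the number of columns strictly between `a` and `b`. Exchanging column `b` with its
  -- left neighbour `h` costs a sign and brings the two equal columns one step closer.
  alternating-< : ∀ {k} d {a b : Fin k} → toℕ b ≡ suc (d ℕ.+ toℕ a) → Alternating a b
  alternating-< zero    b≡ = alternating-adjacent b≡
  alternating-< {k} (suc d) {a} {b} b≡ {M} Ma≈Mb = begin
    det M       ≈⟨ det-swap h≢b (alternating-adjacent (≡.trans b≡ (cong suc (≡.sym h≡)))) M-h M-b M-other ⟩
    - det N     ≈⟨ -‿cong (alternating-< d h≡ N-ah) ⟩
    - 0#        ≈⟨ -0#≈0# ⟩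
    0#          ∎
    where
    h<k : suc (d ℕ.+ toℕ a) < k
    h<k = ℕ.<-trans (ℕ.≤-reflexive (≡.sym b≡)) (toℕ<n b)
    h : Fin k
    h = fromℕ< h<k
    h≡ : toℕ h ≡ suc (d ℕ.+ toℕ a)
    h≡ = toℕ-fromℕ< h<k
    h≢b : h ≢ b
    h≢b e = ℕ.1+n≢n (≡.trans (≡.sym b≡) (≡.trans (cong toℕ (≡.sym e)) h≡))
    a≢h : a ≢ h
    a≢h e = ℕ.m≢1+n+m (toℕ a) (≡.trans (cong toℕ e) h≡)
    a≢b : a ≢ b
    a≢b e = ℕ.m≢1+n+m (toℕ a) (≡.trans (cong toℕ e) b≡)
    M′ N : Matrix k
    M′ = M [ h ≔ column M b ]
    N = M′ [ b ≔ column M h ]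
    N-h : ∀ i → N i h ≈ M i b
    N-h i = trans ([≔]-other M′ b (column M h) i h≢b) ([≔]-same M h (column M b) i)
    M-h : ∀ i → M i h ≈ N i b
    M-h i = sym ([≔]-same M′ b (column M h) i)
    M-b : ∀ i → M i b ≈ N i h
    M-b i = sym (N-h i)
    M-other : ∀ i l → l ≢ h → l ≢ b → M i l ≈ N i l
    M-other i l l≢h l≢b = sym (trans ([≔]-other M′ b (column M h) i l≢b) ([≔]-other M h (column M b) i l≢h))
    N-ah : ∀ i → N i a ≈ N i h
    N-ah i = trans (sym (M-other i a a≢h a≢b)) (trans (Ma≈Mb i) (M-b i))

  alternating : ∀ {k} {a b : Fin k} → a ≢ b → Alternating a b
  alternating {a = a} {b} a≢b with ℕ.<-cmp (toℕ a) (toℕ b)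
  ... | tri≈ _ e _   = contradiction (toℕ-injective e) a≢b
  ... | tri< a<b _ _ = alternating-< _ (≡.trans (≡.sym (ℕ.m∸n+n≡m a<b)) (ℕ.+-suc _ _))
  ... | tri> _ _ b<a = λ Ma≈Mb →
    alternating-< _ (≡.trans (≡.sym (ℕ.m∸n+n≡m b<a)) (ℕ.+-suc _ _)) (λ i → sym (Ma≈Mb i))

-- Indicators and Kronecker deltas.

module Indicator {c ℓ} (S : Semiring c ℓ) where
  open Semiring S hiding (zero)
  open SumProperties S
  open Relation.Binary.Reasoning.Setoid setoid

  -- Goes through `does`, exactly as the entries of `𝓐` do, so that these entries are indicators by
  -- definition.
  [_] : ∀ {p} {P : Set p} → Dec P → Carrier
  [ P? ] = if does P? then 1# else 0#

  []-yes : ∀ {p} {P : Set p} (P? : Dec P) → P → [ P? ] ≡ 1#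
  []-yes P? p rewrite dec-true P? p = ≡.refl

  []-no : ∀ {p} {P : Set p} (P? : Dec P) → ¬ P → [ P? ] ≡ 0#
  []-no P? ¬p rewrite dec-false P? ¬p = ≡.refl

  []-cong : ∀ {p q} {P : Set p} {Q : Set q} (P? : Dec P) (Q? : Dec Q) →
            (P → Q) → (Q → P) → [ P? ] ≡ [ Q? ]
  []-cong P? (yes q) f g = []-yes P? (g q)
  []-cong P? (no ¬q) f g = []-no P? (¬q ∘ f)

  []-⊎ : ∀ {p q} {P : Set p} {Q : Set q} (P? : Dec P) (Q? : Dec Q) →
         ¬ (P Product.× Q) → [ P? ⊎-dec Q? ] ≈ [ P? ] + [ Q? ]
  []-⊎ (yes p) (yes q) ¬pq = contradiction (p , q) ¬pq
  []-⊎ (yes p) (no _)  ¬pq = sym (+-identityʳ 1#)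
  []-⊎ (no _)  Q?      ¬pq = sym (+-identityˡ [ Q? ])

  -- Indexed by natural numbers, so that parents and vertex labels can be compared without carrying
  -- bounds.
  δ : ℕ → ℕ → Carrier
  δ a b = [ a ℕ.≟ b ]

  δ-≡ : ∀ {a b} → a ≡ b → δ a b ≈ 1#
  δ-≡ {a} {b} a≡b = reflexive ([]-yes (a ℕ.≟ b) a≡b)

  δ-≢ : ∀ {a b} → a ≢ b → δ a b ≈ 0#
  δ-≢ {a} {b} a≢b = reflexive ([]-no (a ℕ.≟ b) a≢b)

  δ-sym : ∀ a b → δ a b ≈ δ b a
  δ-sym a b = reflexive ([]-cong (a ℕ.≟ b) (b ℕ.≟ a) ≡.sym ≡.sym)

  []-× : ∀ {p q} {P : Set p} {Q : Set q} (P? : Dec P) (Q? : Dec Q) →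
         [ P? ×-dec Q? ] ≈ [ P? ] * [ Q? ]
  []-× (yes _) Q? = sym (*-identityˡ [ Q? ])
  []-× (no  _) Q? = sym (zeroˡ [ Q? ])

  δ-idem : ∀ a b → δ a b * δ a b ≈ δ a b
  δ-idem a b with does (a ℕ.≟ b)
  ... | true  = *-identityˡ 1#
  ... | false = zeroˡ 0#

  δ-disjoint : ∀ {a b} c → a ≢ b → δ a c * δ b c ≈ 0#
  δ-disjoint {a} {b} c a≢b with a ℕ.≟ c
  ... | yes ≡.refl = trans (*-congˡ (δ-≢ (a≢b ∘ ≡.sym))) (zeroʳ _)
  ... | no  a≢c    = trans (*-congʳ (δ-≢ a≢c)) (zeroˡ _)

  sum-δ : ∀ {N a} → a < N → (f : ℕ → Carrier) → sum {N} (λ l → δ a (toℕ l) * f (toℕ l)) ≈ f a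
  sum-δ {N} {a} a<N f = begin
    sum {N} (λ l → δ a (toℕ l) * f (toℕ l))
      ≈⟨ sum-single (fromℕ< a<N) (λ l l≢a → trans
           (*-congʳ (δ-≢ λ a≡l → l≢a (toℕ-injective (≡.trans (≡.sym a≡l) (≡.sym (toℕ-fromℕ< a<N))))))
           (zeroˡ _)) ⟩
    δ a (toℕ (fromℕ< a<N)) * f (toℕ (fromℕ< a<N))  ≡⟨ cong (λ z → δ a z * f z) (toℕ-fromℕ< a<N) ⟩
    δ a a * f a                                    ≈⟨ trans (*-congʳ (δ-≡ {a} ≡.refl)) (*-identityˡ _) ⟩
    f a                                            ∎

  sum-δ-1 : ∀ {N a} → a < N → sum {N} (λ l → δ (toℕ l) a) ≈ 1#
  sum-δ-1 {N} {a} a<N = trans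
    (sum-cong-≋ {N} λ l → trans (δ-sym (toℕ l) a) (sym (*-identityʳ _)))
    (sum-δ a<N (λ _ → 1#))

-- Column operations, and matrices that differ from the identity in three rows.

module ColumnOperations {c ℓ} (R : CommutativeRing c ℓ) where
  open CommutativeRing R hiding (zero)
  open Algebra.Properties.Ring ring
  open SumProperties semiring
  open Indicator semiring
  open Zeta R using (Matrix; det)
  open RingSolver R
  open Determinant R
  open Relation.Binary.Reasoning.Setoid setoid

  -- Columns are exchanged one at a time from left to right. When column `j` is reached, those to
  -- its left already come from `B` and those to its right still from `A`; the exchange may rely on
  -- this.
  det-replace-columns : ∀ {k} (A B : Matrix k) →
    (∀ j H → (∀ i l → toℕ l < toℕ j → H i l ≈ B i l) → (∀ i l → toℕ j < toℕ l → H i l ≈ A i l) →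
             det (H [ j ≔ column A j ]) ≈ det (H [ j ≔ column B j ])) →
    det A ≈ det B
  det-replace-columns {k} A B replace = begin
    det A          ≈⟨ prefix k ℕ.≤-refl ⟩
    det (hybrid k) ≈⟨ det-cong (λ i j → hybrid-< k i (toℕ<n j)) ⟩
    det B          ∎
    where
    hybrid : ℕ → Matrix k
    hybrid s i l = if does (toℕ l ℕ.<? s) then B i l else A i l
    hybrid-< : ∀ s i {l} → toℕ l < s → hybrid s i l ≈ B i l
    hybrid-< s i {l} l<s rewrite dec-true (toℕ l ℕ.<? s) l<s = refl
    hybrid-≥ : ∀ s i {l} → s ≤ toℕ l → hybrid s i l ≈ A i l
    hybrid-≥ s i {l} s≤l rewrite dec-false (toℕ l ℕ.<? s) (ℕ.≤⇒≯ s≤l) = refl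
    prefix : ∀ s → s ≤ k → det A ≈ det (hybrid s)
    prefix zero    _   = det-cong λ i j → sym (hybrid-≥ 0 i ℕ.z≤n)
    prefix (suc s) s<k = begin
      det A                               ≈⟨ prefix s (ℕ.<⇒≤ s<k) ⟩
      det (hybrid s)                      ≈⟨ det-cong before ⟩
      det (hybrid s [ j ≔ column A j ])
        ≈⟨ replace j (hybrid s) (λ i l l<j → hybrid-< s i (subst (toℕ l <_) j≡ l<j))
                                               (λ i l j<l → hybrid-≥ s i (ℕ.<⇒≤ (subst (_< toℕ l) j≡ j<l))) ⟩
      det (hybrid s [ j ≔ column B j ])   ≈⟨ det-cong after ⟩
      det (hybrid (suc s))                ∎
      where
      j = fromℕ< s<k
      j≡ : toℕ j ≡ s
      j≡ = toℕ-fromℕ< s<k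
      before : ∀ i l → hybrid s i l ≈ (hybrid s [ j ≔ column A j ]) i l
      before i l with l ≟ j
      ... | yes ≡.refl = hybrid-≥ s i (ℕ.≤-reflexive (≡.sym j≡))
      ... | no  _      = refl
      after : ∀ i l → (hybrid s [ j ≔ column B j ]) i l ≈ hybrid (suc s) i l
      after i l with l ≟ j
      ... | yes ≡.refl = sym (hybrid-< (suc s) i (ℕ.s≤s (ℕ.≤-reflexive j≡)))
      ... | no l≢j with ℕ.<-cmp (toℕ l) s
      ...   | tri< l<s _ _ = trans (hybrid-< s i l<s) (sym (hybrid-< (suc s) i (ℕ.m<n⇒m<1+n l<s)))
      ...   | tri≈ _ l≡s _ = contradiction (toℕ-injective (≡.trans l≡s (≡.sym j≡))) l≢j
      ...   | tri> _ _ s<l = trans (hybrid-≥ s i (ℕ.<⇒≤ s<l)) (sym (hybrid-≥ (suc s) i s<l))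

  -- Linearity in column `j` yields one extra determinant per `l`: it has a repeated column unless
  -- `l` is `j`, where the coefficient is zero.
  det-column-op : ∀ {k} {M N : Matrix k} j (t : Fin k → Carrier) → t j ≈ 0# →
    (∀ i → N i j ≈ M i j + sum (λ l → t l * M i l)) → (∀ i l → l ≢ j → N i l ≈ M i l) →
    det N ≈ det M
  det-column-op {k} {M} {N} j t tj≈0 Nj≈ N≈M = begin
    det N                              ≈⟨ det-linear {A = M} j 1# split (λ i l l≢j → sym (N≈M i l l≢j))
                                            (λ i l l≢j → trans ([≔]-other M j v i l≢j) (sym (N≈M i l l≢j))) ⟩
    det M + 1# * det (M [ j ≔ v ])     ≈⟨ +-congˡ (*-congˡ (begin
      det (M [ j ≔ v ])
        ≈⟨ det-column-sum j t V v≈ (λ s i l l≢j → trans ([≔]-other M j (column M s) i l≢j) (sym ([≔]-other M j v i l≢j))) ⟩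
      sum (λ l → t l * det (V l))                  ≈⟨ sum-zero _ vanish ⟩
      0#                                           ∎)) ⟩
    det M + 1# * 0#                    ≈⟨ trans (+-congˡ (zeroʳ 1#)) (+-identityʳ _) ⟩
    det M                              ∎
    where
    v : Fin k → Carrier
    v i = sum (λ l → t l * M i l)
    V : Fin k → Matrix k
    V l = M [ j ≔ column M l ]
    split : ∀ i → N i j ≈ M i j + 1# * (M [ j ≔ v ]) i j
    split i = trans (Nj≈ i) (+-congˡ (sym (trans (*-identityˡ _) ([≔]-same M j v i))))
    v≈ : ∀ i → (M [ j ≔ v ]) i j ≈ sum (λ l → t l * V l i j)
    v≈ i = trans ([≔]-same M j v i) (sum-cong-≋ λ l → *-congˡ (sym ([≔]-same M j (column M l) i)))
    vanish : ∀ l → t l * det (V l) ≈ 0#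
    vanish l with l ≟ j
    ... | yes ≡.refl = trans (*-congʳ tj≈0) (zeroˡ _)
    ... | no l≢j     = trans (*-congˡ (alternating l≢j λ i →
      trans ([≔]-other M j (column M l) i l≢j) (sym ([≔]-same M j (column M l) i)))) (zeroʳ _)

  private
    -- In a partly replaced matrix the operation must combine columns of `H`, not of `C`; agreement
    -- is required only where the coefficient does not vanish.
    hybrid-op : ∀ {k} {C C′ H : Matrix k} j (t : Fin k → Carrier) → t j ≈ 0# →
      (∀ i → C′ i j ≈ C i j + sum (λ l → t l * C i l)) →
      (∀ l → l ≢ j → t l ≈ 0# ⊎ (∀ i → H i l ≈ C i l)) →
      det (H [ j ≔ column C′ j ]) ≈ det (H [ j ≔ column C j ])
    hybrid-op {k} {C} {C′} {H} j t tj≈0 C′≈ agree = det-column-op j t tj≈0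
      (λ i → trans ([≔]-same H j (column C′ j) i) (trans (C′≈ i)
        (+-cong (sym ([≔]-same H j (column C j) i)) (sum-cong-≋ (term i)))))
      (λ i l l≢j → trans ([≔]-other H j (column C′ j) i l≢j) (sym ([≔]-other H j (column C j) i l≢j)))
      where
      both-zero : ∀ {x} y z → x ≈ 0# → x * y ≈ x * z
      both-zero y z x≈0 = trans (*-congʳ x≈0) (trans (zeroˡ y) (sym (trans (*-congʳ x≈0) (zeroˡ z))))
      term : ∀ i l → t l * C i l ≈ t l * (H [ j ≔ column C j ]) i l
      term i l with l ≟ j
      ... | yes ≡.refl = refl
      ... | no l≢j with agree l l≢j
      ...   | inj₁ tl≈0 = both-zero _ _ tl≈0
      ...   | inj₂ H≈C  = *-congˡ (sym (H≈C i))

  -- Right multiplication by the lower unitriangular matrix `identity` + `t`. Each column receives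
  -- columns to its right, and in the passage from `C` to `C′` these are still untouched.
  det-lower-op : ∀ {k} {C C′ : Matrix k} (t : Matrix k) → (∀ l j → toℕ l ≤ toℕ j → t l j ≈ 0#) →
    (∀ i j → C′ i j ≈ C i j + sum (λ l → t l j * C i l)) → det C′ ≈ det C
  det-lower-op {C = C} {C′} t t≈0 C′≈ = sym (det-replace-columns C C′ λ j H _ H> →
    sym (hybrid-op {C′ = C′} j (λ l → t l j) (t≈0 j j ℕ.≤-refl) (λ i → C′≈ i j) λ l l≢j → agree j H H> l))
    where
    agree : ∀ j H → (∀ i l → toℕ j < toℕ l → H i l ≈ C i l) →
            ∀ l → t l j ≈ 0# ⊎ (∀ i → H i l ≈ C i l)
    agree j H H> l with toℕ l ℕ.≤? toℕ j
    ... | yes l≤j = inj₁ (t≈0 l j l≤j)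
    ... | no  l≰j = inj₂ λ i → H> i l (ℕ.≰⇒> l≰j)

  -- Now each column receives columns to its left, so the passage runs from `C′` back to `C`, where
  -- these are already restored.
  det-upper-op : ∀ {k} {C C′ : Matrix k} (t : Matrix k) → (∀ l j → toℕ j ≤ toℕ l → t l j ≈ 0#) →
    (∀ i j → C′ i j ≈ C i j + sum (λ l → t l j * C i l)) → det C′ ≈ det C
  det-upper-op {C = C} {C′} t t≈0 C′≈ = det-replace-columns C′ C λ j H H< _ →
    hybrid-op {C′ = C′} j (λ l → t l j) (t≈0 j j ℕ.≤-refl) (λ i → C′≈ i j) λ l l≢j → agree j H H< l
    where
    agree : ∀ j H → (∀ i l → toℕ l < toℕ j → H i l ≈ C i l) →
            ∀ l → t l j ≈ 0# ⊎ (∀ i → H i l ≈ C i l)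
    agree j H H< l with toℕ j ℕ.≤? toℕ l
    ... | yes j≤l = inj₁ (t≈0 l j j≤l)
    ... | no  j≰l = inj₂ λ i → H< i l (ℕ.≰⇒> j≰l)

  identity : ∀ {k} → Matrix k
  identity i j = δ (toℕ i) (toℕ j)

  det-identity : ∀ k → det (identity {k}) ≈ 1#
  det-identity zero    = refl
  det-identity (suc k) = begin
    sum (cofactor (identity {suc k}))
      ≈⟨ sum-single {f = cofactor (identity {suc k})} zero (λ
           { zero    0≢0 → contradiction ≡.refl 0≢0
           ; (suc j) _   → trans (*-congˡ {(- 1#) ^ suc (toℕ j)} (zeroˡ (det (minor (identity {suc k}) (suc j))))) (zeroʳ _)
           }) ⟩
    1# * (1# * det (identity {k}))        ≈⟨ trans (*-identityˡ _) (*-identityˡ _) ⟩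
    det (identity {k})                    ≈⟨ det-identity k ⟩
    1#                                    ∎
    where open Algebra.Properties.Semiring.Exp semiring

  identity-≢ : ∀ {k} {i j : Fin k} → i ≢ j → identity i j ≈ 0#
  identity-≢ i≢j = δ-≢ (i≢j ∘ toℕ-injective)

  ⟨_,_,_⟩ : ∀ {x} {X : Set x} → X → X → X → Fin 3 → X
  ⟨ u , v , w ⟩ 0F = u
  ⟨ u , v , w ⟩ 1F = v
  ⟨ u , v , w ⟩ 2F = w

  det₃ : (Fin 3 → Fin 3 → Carrier) → Carrier
  det₃ x = x 0F 0F * (x 1F 1F * x 2F 2F - x 1F 2F * x 2F 1F)
         - x 0F 1F * (x 1F 0F * x 2F 2F - x 1F 2F * x 2F 0F)
         + x 0F 2F * (x 1F 0F * x 2F 1F - x 1F 1F * x 2F 0F)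

  det₃-cong : ∀ {x y} → (∀ s t → x s t ≈ y s t) → det₃ x ≈ det₃ y
  det₃-cong {x} {y} x≈y =
    +-cong (//-cong₂ (*-cong (x≈y 0F 0F) (2×2 1F 2F)) (*-cong (x≈y 0F 1F) (2×2 0F 2F)))
           (*-cong (x≈y 0F 2F) (2×2 0F 1F))
    where
    2×2 : ∀ s t → x 1F s * x 2F t - x 1F t * x 2F s ≈ y 1F s * y 2F t - y 1F t * y 2F s
    2×2 s t = //-cong₂ (*-cong (x≈y 1F s) (x≈y 2F t)) (*-cong (x≈y 1F t) (x≈y 2F s))

  -- The three values are parameters so that one table serves both ring elements and solver
  -- polynomials.
  leviCivita : ∀ {x} {X : Set x} → X → X → X → Fin 3 → Fin 3 → Fin 3 → X
  leviCivita o p n 0F 1F 2F = p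
  leviCivita o p n 1F 2F 0F = p
  leviCivita o p n 2F 0F 1F = p
  leviCivita o p n 0F 2F 1F = n
  leviCivita o p n 1F 0F 2F = n
  leviCivita o p n 2F 1F 0F = n
  leviCivita o p n _  _  _  = o

  module ThreeRows {k} (site : Fin 3 → Fin k) (site-injective : ∀ {s t} → site s ≡ site t → s ≡ t) where

    rows : (Fin 3 → Fin k → Carrier) → Matrix k
    rows X i j = identity i j + sum (λ s → X s j * identity i (site s))

    columns : (Fin 3 → Fin k → Carrier) → Matrix k
    columns V i l with any? (λ s → site s ≟ l)
    ... | yes (s , _) = V s i
    ... | no  _       = identity i l

    columns-site : ∀ V i s → columns V i (site s) ≈ V s i
    columns-site V i s with any? (λ t → site t ≟ site s)
    ... | yes (t , t≡s) = reflexive (cong (λ t → V t i) (site-injective t≡s))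
    ... | no  ∄t        = contradiction (s , ≡.refl) ∄t

    columns-cong : ∀ V W i l → (∀ s → site s ≡ l → V s i ≈ W s i) → columns V i l ≈ columns W i l
    columns-cong V W i l V≈W with any? (λ s → site s ≟ l)
    ... | yes (s , s≡l) = V≈W s s≡l
    ... | no  _         = refl

    columns-identity : ∀ V i l → (∀ s → site s ≡ l → V s i ≈ identity i l) → columns V i l ≈ identity i l
    columns-identity V i l V≈ with any? (λ s → site s ≟ l)
    ... | yes (s , s≡l) = V≈ s s≡l
    ... | no  _         = refl

    -- The columns of `rows X` away from the sites may be replaced by those of
    -- the identity: the difference has a zero row.
    det-rows : ∀ X → det (rows X) ≈ det (columns λ s → column (rows X) (site s))
    det-rows X = det-replace-columns (rows X) Z λ j → replace j (any? (λ s → site s ≟ j))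
      where
      Z : Matrix k
      Z = columns λ s → column (rows X) (site s)
      w : Fin k → Fin k → Carrier
      w j i = sum (λ s → X s j * identity i (site s))
      w-other : ∀ {i} j → (∀ s → site s ≢ i) → w j i ≈ 0#
      w-other j site≢i = sum-zero _ λ s → trans (*-congˡ {X s j} (identity-≢ (site≢i s ∘ ≡.sym))) (zeroʳ _)
      replace : ∀ j → Dec (∃ λ s → site s ≡ j) →
                ∀ H → (∀ i l → toℕ l < toℕ j → H i l ≈ Z i l) → (∀ i l → toℕ j < toℕ l → H i l ≈ rows X i l) →
                det (H [ j ≔ column (rows X) j ]) ≈ det (H [ j ≔ column Z j ])
      replace j (yes (s , ≡.refl)) H H< H> = det-cong same
        where
        same : ∀ i l → (H [ j ≔ column (rows X) j ]) i l ≈ (H [ j ≔ column Z j ]) i l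
        same i l with does (l ≟ j)
        ... | true  = sym (columns-site _ i s)
        ... | false = refl
      replace j (no ∄s) H H< H> = begin
        det (H [ j ≔ column (rows X) j ])
          ≈⟨ det-linear {A = H [ j ≔ column Z j ]} {H [ j ≔ w j ]} j 1# split
               (λ i l l≢j → trans ([≔]-other H j (column Z j) i l≢j) (sym ([≔]-other H j (column (rows X) j) i l≢j)))
               (λ i l l≢j → trans ([≔]-other H j (w j) i l≢j) (sym ([≔]-other H j (column (rows X) j) i l≢j))) ⟩
        det (H [ j ≔ column Z j ]) + 1# * det (H [ j ≔ w j ])
          ≈⟨ +-congˡ (*-congˡ (det-zero-row j zero-row)) ⟩
        det (H [ j ≔ column Z j ]) + 1# * 0#
          ≈⟨ trans (+-congˡ (zeroʳ 1#)) (+-identityʳ _) ⟩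
        det (H [ j ≔ column Z j ])                              ∎
        where
        site≢j : ∀ s → site s ≢ j
        site≢j s e = ∄s (s , e)
        split : ∀ i → (H [ j ≔ column (rows X) j ]) i j ≈ (H [ j ≔ column Z j ]) i j + 1# * (H [ j ≔ w j ]) i j
        split i = trans ([≔]-same H j (column (rows X) j) i) (sym (+-cong
          (trans ([≔]-same H j (column Z j) i) (columns-identity _ i j λ s e → contradiction e (site≢j s)))
          (trans (*-identityˡ _) ([≔]-same H j (w j) i))))
        rows-j : ∀ l → j ≢ l → rows X j l ≈ 0#
        rows-j l j≢l = trans (+-cong (identity-≢ j≢l) (w-other l site≢j)) (+-identityʳ _)
        -- As `j` is not a site, row `j` of both `rows X` and `Z` is that of the identity, hence
        -- zero off the diagonal; the diagonal place now holds `w j j`, a sum over sites different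
        -- from `j`.
        zero-row : ∀ l → (H [ j ≔ w j ]) j l ≈ 0#
        zero-row l with l ≟ j
        ... | yes ≡.refl = w-other j site≢j
        ... | no l≢j with ℕ.<-cmp (toℕ l) (toℕ j)
        ...   | tri≈ _ l≡j _ = contradiction (toℕ-injective l≡j) l≢j
        ...   | tri> _ _ j<l = trans (H> j l j<l) (rows-j l (l≢j ∘ ≡.sym))
        ...   | tri< l<j _ _ = trans (H< j l l<j) (trans (columns-identity _ j l λ s e →
                  subst (λ z → rows X j z ≈ identity j l) (≡.sym e) (trans (rows-j l (l≢j ∘ ≡.sym)) (sym (identity-≢ (l≢j ∘ ≡.sym)))))
                  (identity-≢ (l≢j ∘ ≡.sym)))

    e : Fin 3 → Fin k → Carrier
    e s i = identity i (site s)

    T : Fin 3 → Fin 3 → Fin 3 → Carrier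
    T r s t = det (columns ⟨ e r , e s , e t ⟩)

    -- Trilinear expansion in the three site columns. What remains are identity matrices whose site
    -- columns are permuted or repeated, that is, the Levi-Civita symbol.
    det-columns : ∀ (x y z : Fin 3 → Carrier) →
      det (columns ⟨ (λ i → sum (λ s → x s * e s i)) , (λ i → sum (λ s → y s * e s i)) , (λ i → sum (λ s → z s * e s i)) ⟩)
      ≈ sum (λ r → x r * sum (λ s → y s * sum (λ t → z t * T r s t)))
    det-columns x y z = trans expand₀ (sum-cong-≋ λ r → *-congˡ {x r} (trans (expand₁ r) (sum-cong-≋ λ s → *-congˡ {y s} (expand₂ r s))))
      where
      vec : (Fin 3 → Carrier) → Fin k → Carrier
      vec x i = sum (λ s → x s * e s i)
      expand₀ : det (columns ⟨ vec x , vec y , vec z ⟩) ≈ sum (λ r → x r * det (columns ⟨ e r , vec y , vec z ⟩))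
      expand₀ = det-column-sum (site 0F) x (λ r → columns ⟨ e r , vec y , vec z ⟩)
        (λ i → trans (columns-site _ i 0F) (sum-cong-≋ λ r → *-congˡ {x r} (sym (columns-site ⟨ e r , vec y , vec z ⟩ i 0F))))
        (λ r i l l≢ → columns-cong _ _ i l λ { 0F p → contradiction (≡.sym p) l≢ ; 1F _ → refl ; 2F _ → refl })
      expand₁ : ∀ r → det (columns ⟨ e r , vec y , vec z ⟩) ≈ sum (λ s → y s * det (columns ⟨ e r , e s , vec z ⟩))
      expand₁ r = det-column-sum (site 1F) y (λ s → columns ⟨ e r , e s , vec z ⟩)
        (λ i → trans (columns-site _ i 1F) (sum-cong-≋ λ s → *-congˡ {y s} (sym (columns-site ⟨ e r , e s , vec z ⟩ i 1F))))
        (λ s i l l≢ → columns-cong _ _ i l λ { 0F _ → refl ; 1F p → contradiction (≡.sym p) l≢ ; 2F _ → refl })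
      expand₂ : ∀ r s → det (columns ⟨ e r , e s , vec z ⟩) ≈ sum (λ t → z t * T r s t)
      expand₂ r s = det-column-sum (site 2F) z (λ t → columns ⟨ e r , e s , e t ⟩)
        (λ i → trans (columns-site _ i 2F) (sum-cong-≋ λ t → *-congˡ {z t} (sym (columns-site ⟨ e r , e s , e t ⟩ i 2F))))
        (λ t i l l≢ → columns-cong _ _ i l λ { 0F _ → refl ; 1F _ → refl ; 2F p → contradiction (≡.sym p) l≢ })

    private
      0≢1 : site 0F ≢ site 1F
      0≢1 p with () ← site-injective p
      0≢2 : site 0F ≢ site 2F
      0≢2 p with () ← site-injective p
      1≢2 : site 1F ≢ site 2F
      1≢2 p with () ← site-injective p

    T-equal₀₁ : ∀ r t → T r r t ≈ 0#
    T-equal₀₁ r t = alternating 0≢1 λ i → trans (columns-site _ i 0F) (sym (columns-site ⟨ e r , e r , e t ⟩ i 1F))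

    T-equal₀₂ : ∀ r s → T r s r ≈ 0#
    T-equal₀₂ r s = alternating 0≢2 λ i → trans (columns-site _ i 0F) (sym (columns-site ⟨ e r , e s , e r ⟩ i 2F))

    T-equal₁₂ : ∀ r s → T r s s ≈ 0#
    T-equal₁₂ r s = alternating 1≢2 λ i → trans (columns-site _ i 1F) (sym (columns-site ⟨ e r , e s , e s ⟩ i 2F))

    T-swap₀₁ : ∀ r s t → T r s t ≈ - T s r t
    T-swap₀₁ r s t = det-swap 0≢1 (alternating 0≢1)
      (λ i → trans (columns-site _ i 0F) (sym (columns-site ⟨ e s , e r , e t ⟩ i 1F)))
      (λ i → trans (columns-site _ i 1F) (sym (columns-site ⟨ e s , e r , e t ⟩ i 0F)))
      (λ i l l≢0 l≢1 → columns-cong _ _ i l λ { 0F p → contradiction (≡.sym p) l≢0 ; 1F p → contradiction (≡.sym p) l≢1 ; 2F _ → refl })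

    T-swap₁₂ : ∀ r s t → T r s t ≈ - T r t s
    T-swap₁₂ r s t = det-swap 1≢2 (alternating 1≢2)
      (λ i → trans (columns-site _ i 1F) (sym (columns-site ⟨ e r , e t , e s ⟩ i 2F)))
      (λ i → trans (columns-site _ i 2F) (sym (columns-site ⟨ e r , e t , e s ⟩ i 1F)))
      (λ i l l≢1 l≢2 → columns-cong _ _ i l λ { 0F _ → refl ; 1F p → contradiction (≡.sym p) l≢1 ; 2F p → contradiction (≡.sym p) l≢2 })

    T-identity : T 0F 1F 2F ≈ 1#
    T-identity = trans (det-cong λ i l → columns-identity _ i l λ
      { 0F ≡.refl → refl ; 1F ≡.refl → refl ; 2F ≡.refl → refl }) (det-identity k)

    ε : Fin 3 → Fin 3 → Fin 3 → Carrier
    ε = leviCivita 0# 1# (- 1#)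

    private
      T-021 : T 0F 2F 1F ≈ - 1#
      T-021 = trans (T-swap₁₂ 0F 2F 1F) (-‿cong T-identity)
      T-102 : T 1F 0F 2F ≈ - 1#
      T-102 = trans (T-swap₀₁ 1F 0F 2F) (-‿cong T-identity)
      T-120 : T 1F 2F 0F ≈ 1#
      T-120 = trans (T-swap₁₂ 1F 2F 0F) (trans (-‿cong T-102) (-‿involutive 1#))

    T≈ε : ∀ r s t → T r s t ≈ ε r s t
    T≈ε 0F 0F 0F = T-equal₀₁ 0F 0F
    T≈ε 0F 0F 1F = T-equal₀₁ 0F 1F
    T≈ε 0F 0F 2F = T-equal₀₁ 0F 2F
    T≈ε 0F 1F 0F = T-equal₀₂ 0F 1F
    T≈ε 0F 1F 1F = T-equal₁₂ 0F 1F
    T≈ε 0F 1F 2F = T-identity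
    T≈ε 0F 2F 0F = T-equal₀₂ 0F 2F
    T≈ε 0F 2F 1F = T-021
    T≈ε 0F 2F 2F = T-equal₁₂ 0F 2F
    T≈ε 1F 0F 0F = T-equal₁₂ 1F 0F
    T≈ε 1F 0F 1F = T-equal₀₂ 1F 0F
    T≈ε 1F 0F 2F = T-102
    T≈ε 1F 1F 0F = T-equal₀₁ 1F 0F
    T≈ε 1F 1F 1F = T-equal₀₁ 1F 1F
    T≈ε 1F 1F 2F = T-equal₀₁ 1F 2F
    T≈ε 1F 2F 0F = T-120
    T≈ε 1F 2F 1F = T-equal₀₂ 1F 2F
    T≈ε 1F 2F 2F = T-equal₁₂ 1F 2F
    T≈ε 2F 0F 0F = T-equal₁₂ 2F 0F
    T≈ε 2F 0F 1F = trans (T-swap₀₁ 2F 0F 1F) (trans (-‿cong T-021) (-‿involutive 1#))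
    T≈ε 2F 0F 2F = T-equal₀₂ 2F 0F
    T≈ε 2F 1F 0F = trans (T-swap₀₁ 2F 1F 0F) (-‿cong T-120)
    T≈ε 2F 1F 1F = T-equal₁₂ 2F 1F
    T≈ε 2F 1F 2F = T-equal₀₂ 2F 1F
    T≈ε 2F 2F 0F = T-equal₀₁ 2F 0F
    T≈ε 2F 2F 1F = T-equal₀₁ 2F 1F
    T≈ε 2F 2F 2F = T-equal₀₁ 2F 2F

    det-three-rows : ∀ X → det (rows X) ≈ det₃ (λ s t → δ (toℕ s) (toℕ t) + X s (site t))
    det-three-rows X = begin
      det (rows X)                                                  ≈⟨ det-rows X ⟩
      det (columns λ s → column (rows X) (site s))
        ≈⟨ det-cong (λ i l → columns-cong _ _ i l λ { 0F _ → column₀ i ; 1F _ → column₁ i ; 2F _ → column₂ i }) ⟩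
      det (columns ⟨ vec c₀ , vec c₁ , vec c₂ ⟩)                    ≈⟨ det-columns c₀ c₁ c₂ ⟩
      sum (λ r → c₀ r * sum (λ s → c₁ s * sum (λ t → c₂ t * T r s t)))
        ≈⟨ sum-cong-≋ (λ r → *-congˡ {c₀ r} (sum-cong-≋ λ s → *-congˡ {c₁ s} (sum-cong-≋ λ t → *-congˡ {c₂ t} (T≈ε r s t)))) ⟩
      sum (λ r → c₀ r * sum (λ s → c₁ s * sum (λ t → c₂ t * ε r s t)))
        ≈⟨ solve 9 (λ x₀₀ x₀₁ x₀₂ x₁₀ x₁₁ x₁₂ x₂₀ x₂₁ x₂₂ →
             :sum (λ r → ⟨ :1 :+ x₀₀ , x₁₀ , x₂₀ ⟩ r :*
               :sum (λ s → ⟨ x₀₁ , :1 :+ x₁₁ , x₂₁ ⟩ s :*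
                 :sum (λ t → ⟨ x₀₂ , x₁₂ , :1 :+ x₂₂ ⟩ t :* leviCivita :0 :1 (:- :1) r s t)))
             -- The summands `:1` and `:0` mirror the values to which `δ (toℕ s) (toℕ t)` computes
             -- in the goal, as the final `:0` in `:sum` mirrors the empty sum.
             := (:1 :+ x₀₀) :* ((:1 :+ x₁₁) :* (:1 :+ x₂₂) :- (:0 :+ x₁₂) :* (:0 :+ x₂₁))
                :- (:0 :+ x₀₁) :* ((:0 :+ x₁₀) :* (:1 :+ x₂₂) :- (:0 :+ x₁₂) :* (:0 :+ x₂₀))
                :+ (:0 :+ x₀₂) :* ((:0 :+ x₁₀) :* (:0 :+ x₂₁) :- (:1 :+ x₁₁) :* (:0 :+ x₂₀)))
             refl _ _ _ _ _ _ _ _ _ ⟩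
      _  ∎
      where
      :sum : ∀ {v} → (Fin 3 → Polynomial v) → Polynomial v
      :sum f = f 0F :+ (f 1F :+ (f 2F :+ :0))
      x : Fin 3 → Fin 3 → Carrier
      x s t = X s (site t)
      vec : (Fin 3 → Carrier) → Fin k → Carrier
      vec c i = sum (λ s → c s * e s i)
      c₀ c₁ c₂ : Fin 3 → Carrier
      c₀ = ⟨ 1# + x 0F 0F , x 1F 0F , x 2F 0F ⟩
      c₁ = ⟨ x 0F 1F , 1# + x 1F 1F , x 2F 1F ⟩
      c₂ = ⟨ x 0F 2F , x 1F 2F , 1# + x 2F 2F ⟩
      column₀ : ∀ i → rows X i (site 0F) ≈ vec c₀ i
      column₀ i = solve 6 (λ e₀ e₁ e₂ x y z →
        e₀ :+ (x :* e₀ :+ (y :* e₁ :+ (z :* e₂ :+ :0))) := (:1 :+ x) :* e₀ :+ (y :* e₁ :+ (z :* e₂ :+ :0)))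
        refl _ _ _ _ _ _
      column₁ : ∀ i → rows X i (site 1F) ≈ vec c₁ i
      column₁ i = solve 6 (λ e₀ e₁ e₂ x y z →
        e₁ :+ (x :* e₀ :+ (y :* e₁ :+ (z :* e₂ :+ :0))) := x :* e₀ :+ ((:1 :+ y) :* e₁ :+ (z :* e₂ :+ :0)))
        refl _ _ _ _ _ _
      column₂ : ∀ i → rows X i (site 2F) ≈ vec c₂ i
      column₂ i = solve 6 (λ e₀ e₁ e₂ x y z →
        e₂ :+ (x :* e₀ :+ (y :* e₁ :+ (z :* e₂ :+ :0))) := x :* e₀ :+ (y :* e₁ :+ ((:1 :+ z) :* e₂ :+ :0)))
        refl _ _ _ _ _ _

-- The Green function of a rooted tree.

-- A rooted tree on the natural numbers with root 0, given by its parent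
-- function (the value par 0 is irrelevant).
module RootedTree {c ℓ} (R : CommutativeRing c ℓ) (u : CommutativeRing.Carrier R)
                  (par : ℕ → ℕ) (par≤ : ∀ t → par (suc t) ≤ t) where
  open CommutativeRing R hiding (zero)
  open Algebra.Properties.Ring ring
  open SumProperties semiring
  open Indicator semiring
  open Zeta R using (Matrix; det)
  open RingSolver R
  open ColumnOperations R
  open Relation.Binary.Reasoning.Setoid setoid

  -- The parent of `suc t` is not a structural predecessor, so the recursion is on a bound for the
  -- vertex.
  tree-induction : ∀ {q} (Q : ℕ → Set q) → Q 0 → (∀ t → Q (par (suc t)) → Q (suc t)) → ∀ t → Q t
  tree-induction Q q₀ qₛ t = go t t ℕ.≤-refl
    where
    go : ∀ fuel t → t ≤ fuel → Q t
    go _          zero    _         = q₀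
    go (suc fuel) (suc t) (s≤s t≤f) = qₛ t (go fuel (par (suc t)) (ℕ.≤-trans (par≤ t) t≤f))

  private
    propagate′ : (ℕ → Carrier) → ℕ → ℕ → Carrier
    propagate′ f _          zero    = f 0
    -- A default that `propagate` never reaches: the bound starts at the vertex, and a parent lies
    -- at least one below its child.
    propagate′ f zero       (suc t) = f (suc t)
    propagate′ f (suc fuel) (suc t) = f (suc t) + u * propagate′ f fuel (par (suc t))

    propagate′-fuel : ∀ f m n t → t ≤ m → t ≤ n → propagate′ f m t ≡ propagate′ f n t
    propagate′-fuel f m       n       zero    _         _         = ≡.refl
    propagate′-fuel f (suc m) (suc n) (suc t) (s≤s t≤m) (s≤s t≤n) =
      cong (λ z → f (suc t) + u * z)
        (propagate′-fuel f m n (par (suc t)) (ℕ.≤-trans (par≤ t) t≤m) (ℕ.≤-trans (par≤ t) t≤n))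

  -- The sum of u ^ d * f a over the ancestors a of t, at distance d.
  propagate : (ℕ → Carrier) → ℕ → Carrier
  propagate f t = propagate′ f t t

  propagate-suc : ∀ f t → propagate f (suc t) ≈ f (suc t) + u * propagate f (par (suc t))
  propagate-suc f t = reflexive (cong (λ z → f (suc t) + u * z)
    (propagate′-fuel f t (par (suc t)) (par (suc t)) (par≤ t) ℕ.≤-refl))

  P : ℕ → ℕ → Carrier
  P zero    j = 0#
  P (suc k) j = δ (par (suc k)) j

  P-zero : ∀ k j → k ≤ j → P k j ≈ 0#
  P-zero zero    j _   = refl
  P-zero (suc k) j k<j = δ-≢ (ℕ.<⇒≢ (ℕ.≤-<-trans (par≤ k) k<j))

  -- `W k t` is u to the distance between `k` and `t` if `k` is `t` or an ancestor of it, and zero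
  -- otherwise. Hence `green k t` sums, over the common ancestors s of `k` and `t`, the power of u
  -- whose exponent is the distance from `k` to s plus that from s to `t`.
  W green : ℕ → ℕ → Carrier
  W k t = propagate (δ k) t
  green k t = propagate (λ s → W s t) k

  W-suc : ∀ k t → W k (suc t) ≈ δ k (suc t) + u * W k (par (suc t))
  W-suc k t = propagate-suc (δ k) t

  green-suc : ∀ k t → green (suc k) t ≈ W (suc k) t + u * green (par (suc k)) t
  green-suc k t = propagate-suc (λ s → W s t) k

  W-zero : ∀ k t → t < k → W k t ≈ 0#
  W-zero k = tree-induction (λ t → t < k → W k t ≈ 0#) (λ 0<k → δ-≢ (ℕ.>⇒≢ 0<k)) λ t IH t<k → begin
    W k (suc t)                           ≈⟨ W-suc k t ⟩
    δ k (suc t) + u * W k (par (suc t))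
      ≈⟨ +-cong (δ-≢ (ℕ.>⇒≢ t<k)) (*-congˡ (IH (ℕ.≤-<-trans (par≤ t) (ℕ.<-trans ℕ.≤-refl t<k)))) ⟩
    0# + u * 0#                           ≈⟨ trans (+-identityˡ _) (zeroʳ u) ⟩
    0#                                    ∎

  W-diagonal : ∀ t → W t t ≈ 1#
  W-diagonal zero    = refl
  W-diagonal (suc t) = begin
    W (suc t) (suc t)                                 ≈⟨ W-suc (suc t) t ⟩
    δ (suc t) (suc t) + u * W (suc t) (par (suc t))
      ≈⟨ +-cong (δ-≡ {suc t} ≡.refl) (*-congˡ (W-zero (suc t) (par (suc t)) (s≤s (par≤ t)))) ⟩
    1# + u * 0#                                       ≈⟨ trans (+-congˡ (zeroʳ u)) (+-identityʳ _) ⟩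
    1#                                                ∎

  W-root : ∀ t → W 0 (suc t) ≈ u * W 0 (par (suc t))
  W-root t = trans (W-suc 0 t) (+-identityˡ _)

  green-root : ∀ k → green k 0 ≈ W 0 k
  green-root = tree-induction (λ k → green k 0 ≈ W 0 k) refl λ k IH → begin
    green (suc k) 0                            ≈⟨ green-suc k 0 ⟩
    W (suc k) 0 + u * green (par (suc k)) 0    ≈⟨ trans (+-identityˡ _) (*-congˡ IH) ⟩
    u * W 0 (par (suc k))                  ≈⟨ W-root k ⟨
    W 0 (suc k)                            ∎

  -- `green` recurs on its first argument. The same recursion in the second holds because both can
  -- be unfolded at once and `δ` is symmetric; symmetry of `green` follows from the pair.
  green-suc′ : ∀ k t → green k (suc t) ≈ W (suc t) k + u * green k (par (suc t))
  green-suc′ k t = tree-induction (λ k → green k (suc t) ≈ W (suc t) k + u * green k (par (suc t)))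
    (W-suc 0 t)
    (λ k IH → begin
      green (suc k) (suc t)
        ≈⟨ green-suc k (suc t) ⟩
      W (suc k) (suc t) + u * green (par (suc k)) (suc t)
        ≈⟨ +-cong (W-suc (suc k) t) (*-congˡ IH) ⟩
      (δ (suc k) (suc t) + u * W (suc k) (par (suc t))) + u * (W (suc t) (par (suc k)) + u * green (par (suc k)) (par (suc t)))
        ≈⟨ +-congʳ (+-congʳ (δ-sym (suc k) (suc t))) ⟩
      (δ (suc t) (suc k) + u * W (suc k) (par (suc t))) + u * (W (suc t) (par (suc k)) + u * green (par (suc k)) (par (suc t)))
        ≈⟨ solve 5 (λ u d x y g →
             (d :+ u :* x) :+ u :* (y :+ u :* g)
             := (d :+ u :* y) :+ u :* (x :+ u :* g)) refl u _ _ _ _ ⟩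
      (δ (suc t) (suc k) + u * W (suc t) (par (suc k))) + u * (W (suc k) (par (suc t)) + u * green (par (suc k)) (par (suc t)))
        ≈⟨ +-cong (W-suc (suc t) k) (*-congˡ (green-suc k (par (suc t)))) ⟨
      W (suc t) (suc k) + u * green (suc k) (par (suc t))
        ∎) k

  green-sym : ∀ k t → green k t ≈ green t k
  green-sym k t = tree-induction (λ k → green k t ≈ green t k) (sym (green-root t)) (λ k IH →
    trans (green-suc k t) (trans (+-congˡ (*-congˡ IH)) (sym (green-suc′ t k)))) k

  -- At depth h the diagonal value is 1 + u² + ... + u²ʰ, and `W 0 t` is uʰ: the geometric sum is
  -- closed without dividing by 1 - u².
  green-diagonal : ∀ t → (1# - u * u) * green t t ≈ 1# - u * u * W 0 t * W 0 t
  green-diagonal = tree-induction (λ t → (1# - u * u) * green t t ≈ 1# - u * u * W 0 t * W 0 t)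
    (solve 1 (λ u →
         (:1 :- u :* u) :* :1
         := :1 :- u :* u :* :1 :* :1) refl u) λ t IH → let s = par (suc t) in begin
    (1# - u * u) * green (suc t) (suc t)              ≈⟨ *-congˡ (green-suc t (suc t)) ⟩
    (1# - u * u) * (W (suc t) (suc t) + u * green s (suc t))
      ≈⟨ *-congˡ (+-cong (W-diagonal (suc t)) (*-congˡ (trans (green-suc′ s t) (+-congʳ (W-zero (suc t) s (s≤s (par≤ t))))))) ⟩
    (1# - u * u) * (1# + u * (0# + u * green s s))
      ≈⟨ solve 2 (λ u g →
           (:1 :- u :* u) :* (:1 :+ u :* (:0 :+ u :* g))
           := (:1 :- u :* u) :+ u :* u :* ((:1 :- u :* u) :* g)) refl u _ ⟩
    (1# - u * u) + u * u * ((1# - u * u) * green s s) ≈⟨ +-congˡ (*-congˡ IH) ⟩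
    (1# - u * u) + u * u * (1# - u * u * W 0 s * W 0 s)
      ≈⟨ solve 2 (λ u w →
           (:1 :- u :* u) :+ u :* u :* (:1 :- u :* u :* w :* w)
           := :1 :- u :* u :* (u :* w) :* (u :* w)) refl u _ ⟩
    1# - u * u * (u * W 0 s) * (u * W 0 s)
      ≈⟨ +-congˡ (-‿cong (*-cong (*-congˡ (W-root t)) (W-root t))) ⟨
    1# - u * u * W 0 (suc t) * W 0 (suc t)        ∎

  module _ {N : ℕ} where

    -- The equation Uᵀ W = I, whose sum runs over the children of `j`, whereas `W-suc` is W Uᵀ = I.
    -- The induction therefore climbs from `t` and leaves `j` fixed.
    W-children : ∀ j t → t < N → W j t + sum {N} (λ k → - (u * P (toℕ k) j * W (toℕ k) t)) ≈ δ j t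
    W-children j = tree-induction (λ t → t < N → W j t + S t ≈ δ j t)
      (λ _ → trans (+-congˡ (sum-zero {N} _ base)) (+-identityʳ _)) step
      where
      S : ℕ → Carrier
      S t = sum {N} (λ k → - (u * P (toℕ k) j * W (toℕ k) t))
      base : (k : Fin N) → - (u * P (toℕ k) j * W (toℕ k) 0) ≈ 0#
      base k = helper (toℕ k)
        where
        helper : ∀ k → - (u * P k j * W k 0) ≈ 0#
        helper zero    = solve 2 (λ u w → :- (u :* :0 :* w) := :0) refl u _
        helper (suc k) = solve 2 (λ u p → :- (u :* p :* :0) := :0) refl u _
      step : ∀ t → (par (suc t) < N → W j (par (suc t)) + S (par (suc t)) ≈ δ j (par (suc t))) →
             suc t < N → W j (suc t) + S (suc t) ≈ δ j (suc t)
      step t IH t<N = begin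
        W j (suc t) + S (suc t)
          ≈⟨ +-cong (W-suc j t) (sum-cong-≋ {N} λ k → trans (-‿cong (*-congˡ (trans (W-suc (toℕ k) t) (+-congʳ (δ-sym (toℕ k) (suc t))))))
               (solve 4 (λ u p d w →
                    :- (u :* p :* (d :+ u :* w))
                    := d :* (:- (u :* p)) :+ u :* (:- (u :* p :* w))) refl u _ _ _)) ⟩
        (δ j (suc t) + u * W j s) + sum {N} (λ k → δ (suc t) (toℕ k) * - (u * P (toℕ k) j) + u * - (u * P (toℕ k) j * W (toℕ k) s))
          ≈⟨ +-congˡ (trans (∑-distrib-+ {N} (λ k → δ (suc t) (toℕ k) * - (u * P (toℕ k) j)) (λ k → u * - (u * P (toℕ k) j * W (toℕ k) s)))
               (+-cong (sum-δ t<N (λ k → - (u * P k j))) (sym (*-distribˡ-sum {N} u (λ k → - (u * P (toℕ k) j * W (toℕ k) s)))))) ⟩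
        (δ j (suc t) + u * W j s) + (- (u * δ s j) + u * S s)
          ≈⟨ solve 5 (λ u d w p x →
               (d :+ u :* w) :+ (:- (u :* p) :+ u :* x)
               := d :+ (u :* (w :+ x) :- u :* p)) refl u _ _ _ _ ⟩
        δ j (suc t) + (u * (W j s + S s) - u * δ s j)
          ≈⟨ +-congˡ (+-cong (*-congˡ (IH (ℕ.≤-<-trans (par≤ t) (ℕ.<⇒≤ t<N)))) (-‿cong (*-congˡ (δ-sym s j)))) ⟩
        δ j (suc t) + (u * δ j s - u * δ j s)
          ≈⟨ trans (+-congˡ (-‿inverseʳ _)) (+-identityʳ _) ⟩
        δ j (suc t)  ∎
        where s = par (suc t)

    -- With U = I - u P, the matrix W is the inverse of Uᵀ and green that of
    -- Uᵀ U, so Uᵀ U + K = (I + K green) Uᵀ U, and U is unitriangular.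
    det-tree-plus : (K : Matrix N) →
      det (λ i j → identity i j - u * (P (toℕ i) (toℕ j) + P (toℕ j) (toℕ i))
                   + u * u * sum {N} (λ k → P (toℕ k) (toℕ i) * P (toℕ k) (toℕ j)) + K i j)
      ≈ det (λ i j → identity i j + sum (λ t → K i t * green (toℕ j) (toℕ t)))
    det-tree-plus K = trans (det-lower-op {C = Y} (λ l j → - (u * P (toℕ l) (toℕ j)))
                               (λ l j l≤j → vanish (P-zero (toℕ l) (toℕ j) l≤j)) M≈)
                            (det-upper-op {C = Z} {Y} (λ l j → - (u * P (toℕ j) (toℕ l)))
                               (λ l j j≤l → vanish (P-zero (toℕ j) (toℕ l) j≤l)) (λ i j → Y≈ i (toℕ j) (toℕ<n j)))
      where
      vanish : ∀ {x} → x ≈ 0# → - (u * x) ≈ 0#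
      vanish x≈0 = trans (-‿cong (trans (*-congˡ x≈0) (zeroʳ u))) -0#≈0#
      z y : Fin N → ℕ → Carrier
      z i x = δ (toℕ i) x + sum (λ t → K i t * green x (toℕ t))
      y i x = δ (toℕ i) x - u * P x (toℕ i) + sum (λ t → K i t * W x (toℕ t))
      -- `Y` is the intermediate product Z Uᵀ = Uᵀ + K U⁻¹. The upper operation multiplies `Z` by
      -- Uᵀ; the lower one multiplies `Y` by U and yields Uᵀ U + K.
      Z Y : Matrix N
      Z i j = z i (toℕ j)
      Y i j = y i (toℕ j)
      Y≈ : ∀ i x → x < N → y i x ≈ z i x + sum {N} (λ l → - (u * P x (toℕ l)) * z i (toℕ l))
      Y≈ i zero _ = begin
        δ (toℕ i) 0 - u * 0# + sum (λ t → K i t * W 0 (toℕ t))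
          ≈⟨ solve 3 (λ u d s → d :- u :* :0 :+ s := d :+ s :+ :0) refl u _ _ ⟩
        z i 0 + 0#
          ≈⟨ +-congˡ (sym (sum-zero {N} _ λ l → trans (*-congʳ (vanish refl)) (zeroˡ (z i (toℕ l))))) ⟩
        z i 0 + sum {N} (λ l → - (u * 0#) * z i (toℕ l))  ∎
      Y≈ i (suc x) x<N = begin
        d - u * δ s (toℕ i) + sum (λ t → K i t * W (suc x) (toℕ t))
          ≈⟨ +-cong (+-congˡ (-‿cong (*-congˡ (δ-sym s (toℕ i))))) (sum-cong-≋ {N} λ t → trans (*-congˡ (W≈ (toℕ t)))
               (solve 4 (λ u k g h → k :* (g :- u :* h) := k :* g :+ (:- u) :* (k :* h)) refl u _ _ _)) ⟩
        d - u * δ (toℕ i) s + sum (λ t → K i t * green (suc x) (toℕ t) + - u * (K i t * green s (toℕ t)))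
          ≈⟨ +-congˡ (trans (∑-distrib-+ {N} _ _) (+-congˡ (sym (*-distribˡ-sum {N} (- u) (λ t → K i t * green s (toℕ t)))))) ⟩
        d - u * δ (toℕ i) s + (sum (λ t → K i t * green (suc x) (toℕ t)) + - u * sum (λ t → K i t * green s (toℕ t)))
          ≈⟨ solve 5 (λ u d e g h →
               d :- u :* e :+ (g :+ (:- u) :* h)
               := d :+ g :+ (:- u) :* (e :+ h)) refl u d _ _ _ ⟩
        z i (suc x) + - u * z i s
          ≈⟨ +-congˡ (*-congˡ (sum-δ (ℕ.≤-<-trans (par≤ x) (ℕ.<⇒≤ x<N)) (z i))) ⟨
        z i (suc x) + - u * sum {N} (λ l → δ s (toℕ l) * z i (toℕ l))
          ≈⟨ +-congˡ (*-distribˡ-sum {N} (- u) (λ l → δ s (toℕ l) * z i (toℕ l))) ⟩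
        z i (suc x) + sum {N} (λ l → - u * (δ s (toℕ l) * z i (toℕ l)))
          ≈⟨ +-congˡ (sum-cong-≋ {N} λ l → solve 3 (λ u d z →
               (:- u) :* (d :* z)
               := (:- (u :* d)) :* z) refl u _ _) ⟩
        z i (suc x) + sum {N} (λ l → - (u * δ s (toℕ l)) * z i (toℕ l))  ∎
        where
        s = par (suc x)
        d = δ (toℕ i) (suc x)
        W≈ : ∀ t → W (suc x) t ≈ green (suc x) t - u * green s t
        W≈ t = sym (trans (+-congʳ (green-suc x t)) (solve 3 (λ u w g → w :+ u :* g :- u :* g := w) refl u _ _))
      M≈ : ∀ i j → identity i j - u * (P (toℕ i) (toℕ j) + P (toℕ j) (toℕ i))
                     + u * u * sum {N} (λ k → P (toℕ k) (toℕ i) * P (toℕ k) (toℕ j)) + K i j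
                 ≈ Y i j + sum (λ k → - (u * P (toℕ k) (toℕ j)) * Y i k)
      M≈ i j = sym (begin
        Y i j + sum (λ k → - (u * p k) * Y i k)
          ≈⟨ +-congˡ (sum-cong-≋ {N} λ k → trans
               (solve 5 (λ u p d q s →
                    (:- (u :* p)) :* (d :- u :* q :+ s)
                    := d :* (:- (u :* p)) :+ u :* u :* (q :* p) :+ (:- (u :* p)) :* s) refl u (p k) _ _ _)
               (+-congˡ (trans (*-distribˡ-sum {N} (- (u * p k)) (λ t → K i t * W (toℕ k) (toℕ t)))
                  (sum-cong-≋ {N} λ t → solve 4 (λ u p k w →
                       (:- (u :* p)) :* (k :* w)
                       := k :* (:- (u :* p :* w))) refl u (p k) _ _)))) ⟩
        Y i j + sum (λ k → δ (toℕ i) (toℕ k) * - (u * p k) + u * u * (P (toℕ k) (toℕ i) * p k) + sum (λ t → F k t))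
          ≈⟨ +-congˡ (trans (∑-distrib-+ {N} (λ k → δ (toℕ i) (toℕ k) * - (u * p k) + u * u * (P (toℕ k) (toℕ i) * p k)) (λ k → sum (λ t → F k t)))
               (+-cong (trans (∑-distrib-+ {N} (λ k → δ (toℕ i) (toℕ k) * - (u * p k)) _)
                         (+-cong (sum-δ (toℕ<n i) (λ k → - (u * P k (toℕ j)))) (sym (*-distribˡ-sum {N} (u * u) _))))
                       (∑-comm F))) ⟩
        Y i j + (- (u * P (toℕ i) (toℕ j)) + u * u * PP + sum (λ t → sum (λ k → F k t)))
          ≈⟨ solve 7 (λ u d p q s r f →
               d :- u :* p :+ s :+ (:- (u :* q) :+ u :* u :* r :+ f)
               := d :- u :* (q :+ p) :+ u :* u :* r :+ (s :+ f)) refl u _ _ _ _ _ _ ⟩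
        common + (sum (λ t → K i t * W (toℕ j) (toℕ t)) + sum (λ t → sum (λ k → F k t)))
          ≈⟨ +-congˡ (∑-distrib-+ {N} (λ t → K i t * W (toℕ j) (toℕ t)) (λ t → sum (λ k → F k t))) ⟨
        common + sum (λ t → K i t * W (toℕ j) (toℕ t) + sum (λ k → F k t))
          ≈⟨ +-congˡ (sum-cong-≋ {N} λ t → trans (+-congˡ (sym (*-distribˡ-sum {N} (K i t) (λ k → - (u * p k * W (toℕ k) (toℕ t))))))
               (trans (sym (distribˡ (K i t) _ _)) (*-congˡ (W-children (toℕ j) (toℕ t) (toℕ<n t))))) ⟩
        common + sum (λ t → K i t * identity j t)
          ≈⟨ +-congˡ (sum-single {N} j λ t t≢j → trans (*-congˡ (identity-≢ (t≢j ∘ ≡.sym))) (zeroʳ _)) ⟩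
        common + K i j * identity j j
          ≈⟨ +-congˡ (trans (*-congˡ (δ-≡ {toℕ j} ≡.refl)) (*-identityʳ _)) ⟩
        common + K i j  ∎)
        where
        p : Fin N → Carrier
        p k = P (toℕ k) (toℕ j)
        F : Fin N → Fin N → Carrier
        F k t = K i t * - (u * p k * W (toℕ k) (toℕ t))
        PP common : Carrier
        PP = sum {N} (λ k → P (toℕ k) (toℕ i) * p k)
        common = identity i j - u * (P (toℕ i) (toℕ j) + P (toℕ j) (toℕ i)) + u * u * PP

-- The glued cycles as a tree with two more edges.

-- A spanning tree of the graph: the parent of m is p, and that of any other
-- vertex t > 0 is t - 1. The two edges outside the tree join 0 to m - 1 and to
-- the last vertex.
module SpanningTree (p b c : ℕ) (0<p : 0 < p) where
  open import Data.Nat.Base using (_+_; pred)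
  open ≡ using (sym; trans)

  -- The private paths of the two cycles have `b` + 1 and `c` + 1 inner vertices, labelled `p` + 1
  -- to `a` and `m` to `last`.
  m n a last : ℕ
  m    = suc (suc (b + p))
  n    = suc (suc (c + p))
  a    = suc (b + p)
  last = c + m

  par : ℕ → ℕ
  par t with t ℕ.≟ m
  ... | yes _ = p
  ... | no  _ = pred t

  par-m : par m ≡ p
  par-m with m ℕ.≟ m
  ... | yes _  = ≡.refl
  ... | no m≢m = contradiction ≡.refl m≢m

  par-suc : ∀ t → suc t ≢ m → par (suc t) ≡ t
  par-suc t t≢m with suc t ℕ.≟ m
  ... | yes t≡m = contradiction t≡m t≢m
  ... | no  _   = ≡.refl

  par≤ : ∀ t → par (suc t) ≤ t
  par≤ t with suc t ℕ.≟ m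
  ... | yes ≡.refl = ℕ.m≤n+m p (suc b)
  ... | no  _      = ℕ.≤-refl

  -- Every edge is directed from its smaller to its larger label and thus listed once. `Parent`
  -- excludes the root by a separate clause because `par 0` is a number like any other.
  Parent Extra Edge : ℕ → ℕ → Set
  Parent x zero    = ⊥
  Parent x (suc y) = par (suc y) ≡ x
  Extra x y = x ≡ 0 Product.× (y ≡ a ⊎ y ≡ last)
  Edge x y = Parent x y ⊎ Extra x y

  parent? : ∀ x y → Dec (Parent x y)
  parent? x zero    = no id
  parent? x (suc y) = par (suc y) ℕ.≟ x

  extra? : ∀ x y → Dec (Extra x y)
  extra? x y = (x ℕ.≟ 0) ×-dec ((y ℕ.≟ a) ⊎-dec (y ℕ.≟ last))

  edge? : ∀ x y → Dec (Edge x y)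
  edge? x y = parent? x y ⊎-dec extra? x y

  p<m : p < m
  p<m = ℕ.m<n⇒m<1+n (s≤s (ℕ.m≤n+m p b))

  a<last : a < last
  a<last = ℕ.m≤n+m m c

  edge⇒< : ∀ {x y} → Edge x y → x < y
  edge⇒< {y = suc y} (inj₁ ≡.refl)              = s≤s (par≤ y)
  edge⇒<             (inj₂ (x≡0 , inj₁ y≡a))    = ≡.subst₂ _<_ (sym x≡0) (sym y≡a) ℕ.0<1+n
  edge⇒<             (inj₂ (x≡0 , inj₂ y≡last)) =
    ≡.subst₂ _<_ (sym x≡0) (sym y≡last) (ℕ.≤-<-trans z≤n a<last)

  parent-succ : ∀ {x y} → y ≡ suc x → y ≢ m → Parent x y
  parent-succ {x} ≡.refl y≢m = par-suc x y≢m

  -- This is where 0 < `p` enters. The parent of `a` is `b` + `p`; that of `last` is `p` if `last`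
  -- is `m`, and its positive predecessor otherwise. So neither is a child of the root.
  parent-extra-disjoint : ∀ x y → ¬ (Parent x y Product.× Extra x y)
  parent-extra-disjoint x (suc y) (e , ≡.refl , inj₁ y≡a) =
    ℕ.<⇒≢ (ℕ.<-≤-trans 0<p (ℕ.m≤n+m p b)) (trans (sym e) (trans (par-suc y y≢m) (ℕ.suc-injective y≡a)))
    where
    y≢m : suc y ≢ m
    y≢m y≡m = ℕ.1+n≢n (trans (sym y≡m) y≡a)
  parent-extra-disjoint x (suc y) (e , ≡.refl , inj₂ y≡last) with suc y ℕ.≟ m
  ... | yes _  = ℕ.<⇒≢ 0<p (sym e)
  ... | no y≢m with ≡.refl ← e = y≢m (sym (ℕ.≤-antisym (subst (m ≤_) (sym y≡last) (ℕ.m≤n+m m c)) (s≤s z≤n)))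

  module Adjacency (m> : (p + 1) ⊔ 2 < m) (n> : (p + 1) ⊔ 2 < n) where
    open Glue m n p m> n> hiding (p<m)
    open Graph graph using (Adj)

    order≡last : order ≡ suc last
    order≡last = begin
      order                          ≡⟨ order≡ ⟩
      m + (suc (c + p) ∸ p)          ≡⟨ cong (λ z → m + (z ∸ p)) (ℕ.+-comm (suc c) p) ⟩
      m + (p + suc c ∸ p)            ≡⟨ cong (m +_) (ℕ.m+n∸m≡n p (suc c)) ⟩
      m + suc c                      ≡⟨ ℕ.+-comm m (suc c) ⟩
      suc last                       ∎
      where open ≡.≡-Reasoning

    relabel-≤ : ∀ {j} → j ≤ p → relabel j ≡ j
    relabel-≤ {j} j≤p with j ℕ.≤? p
    ... | yes _  = ≡.refl
    ... | no j≰p = contradiction j≤p j≰p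

    relabel-> : ∀ d → relabel (suc (d + p)) ≡ d + m
    relabel-> d with suc (d + p) ℕ.≤? p
    ... | yes d<p = contradiction d<p (ℕ.≤⇒≯ (ℕ.m≤n+m p d))
    ... | no  _   = trans (cong (m +_) (ℕ.m+n∸n≡m d p)) (ℕ.+-comm m d)

    toℕ-ιₘ : ∀ i → toℕ (ιₘ i) ≡ toℕ i
    toℕ-ιₘ i = toℕ-fromℕ< _

    toℕ-ιₙ : ∀ j → toℕ (ιₙ j) ≡ relabel (toℕ j)
    toℕ-ιₙ j = toℕ-fromℕ< _

    Joined : ℕ → ℕ → Set
    Joined x y = Edge x y ⊎ Edge y x

    next-joinedₘ : ∀ (i j : Fin m) → Next i j → Joined (toℕ i) (toℕ j)
    next-joinedₘ i j (inj₁ j≡1+i)       = inj₁ (inj₁ (parent-succ j≡1+i (ℕ.<⇒≢ (toℕ<n j))))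
    next-joinedₘ i j (inj₂ (1+i≡m , j≡0)) = inj₂ (inj₂ (j≡0 , inj₁ (ℕ.suc-injective 1+i≡m)))

    beyond : ∀ {i} → p < i → ∃ λ d → i ≡ suc (d + p)
    beyond {i} p<i = i ∸ suc p , trans (sym (ℕ.m∸n+n≡m p<i)) (ℕ.+-suc _ p)

    next-joinedₙ : ∀ (i j : Fin n) → Next i j → Joined (relabel (toℕ i)) (relabel (toℕ j))
    next-joinedₙ i j (inj₁ j≡1+i) rewrite j≡1+i = inj₁ (inj₁ (step (toℕ i)))
      where
      step : ∀ i → Parent (relabel i) (relabel (suc i))
      step i with ℕ.<-cmp i p
      ... | tri< i<p _ _ = subst (Parent _) (sym (relabel-≤ i<p))
                             (parent-succ (cong suc (sym (relabel-≤ (ℕ.<⇒≤ i<p)))) (ℕ.<⇒≢ (ℕ.≤-<-trans i<p p<m)))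
      -- Here C_n leaves the shared path: its vertex `p` + 1 is relabelled `m`, the one positive
      -- label whose parent need not be its predecessor.
      ... | tri≈ _ ≡.refl _ = ≡.subst₂ Parent (sym (relabel-≤ ℕ.≤-refl)) (sym (relabel-> 0)) par-m
      ... | tri> _ _ p<i with d , ≡.refl ← beyond p<i =
        ≡.subst₂ Parent (sym (relabel-> d)) (sym (relabel-> (suc d)))
          (parent-succ ≡.refl (ℕ.>⇒≢ (s≤s (ℕ.m≤n+m m d))))
    next-joinedₙ i j (inj₂ (1+i≡n , j≡0)) = inj₂ (inj₂
      ( trans (cong relabel j≡0) (relabel-≤ z≤n)
      , inj₂ (trans (cong relabel (ℕ.suc-injective 1+i≡n)) (relabel-> c))))

    adj⇒joined : ∀ x y → Adj x y → Joined (toℕ x) (toℕ y)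
    adj⇒joined x y (inj₁ (i , j , ij , ≡.refl , ≡.refl)) rewrite toℕ-ιₘ i | toℕ-ιₘ j =
      Sum.[ next-joinedₘ i j , swap ∘ next-joinedₘ j i ] ij
    adj⇒joined x y (inj₂ (i , j , ij , ≡.refl , ≡.refl)) rewrite toℕ-ιₙ i | toℕ-ιₙ j =
      Sum.[ next-joinedₙ i j , swap ∘ next-joinedₙ j i ] ij

    NextIn : ℕ → ℕ → ℕ → Set
    NextIn k i j = j ≡ suc i ⊎ (suc i ≡ k Product.× j ≡ 0)

    nextₘ⇒adj : ∀ {x y i j} → i < m → j < m → toℕ x ≡ i → toℕ y ≡ j → NextIn m i j → Adj x y
    nextₘ⇒adj {x} {y} i<m j<m x≡i y≡j ij = inj₁
      ( fromℕ< i<m , fromℕ< j<m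
      , inj₁ (≡.subst₂ (NextIn m) (sym (toℕ-fromℕ< i<m)) (sym (toℕ-fromℕ< j<m)) ij)
      , toℕ-injective (trans (toℕ-ιₘ _) (trans (toℕ-fromℕ< i<m) (sym x≡i)))
      , toℕ-injective (trans (toℕ-ιₘ _) (trans (toℕ-fromℕ< j<m) (sym y≡j))))

    nextₙ⇒adj : ∀ {x y i j} → i < n → j < n → toℕ x ≡ relabel i → toℕ y ≡ relabel j → NextIn n i j → Adj x y
    nextₙ⇒adj {x} {y} i<n j<n x≡i y≡j ij = inj₂
      ( fromℕ< i<n , fromℕ< j<n
      , inj₁ (≡.subst₂ (NextIn n) (sym (toℕ-fromℕ< i<n)) (sym (toℕ-fromℕ< j<n)) ij)
      , toℕ-injective (trans (toℕ-ιₙ (fromℕ< i<n)) (trans (cong relabel (toℕ-fromℕ< i<n)) (sym x≡i)))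
      , toℕ-injective (trans (toℕ-ιₙ (fromℕ< j<n)) (trans (cong relabel (toℕ-fromℕ< j<n)) (sym y≡j))))

    edge⇒adj : ∀ x y → Edge (toℕ x) (toℕ y) → Adj x y
    edge⇒adj x y (inj₂ (x≡0 , inj₁ y≡a)) = Graph.sym graph {y} {x}
      (nextₘ⇒adj {y} {x} ℕ.≤-refl ℕ.0<1+n y≡a x≡0 (inj₂ (≡.refl , ≡.refl)))
    edge⇒adj x y (inj₂ (x≡0 , inj₂ y≡last)) = Graph.sym graph {y} {x}
      (nextₙ⇒adj {y} {x} {suc (c + p)} {0} ℕ.≤-refl ℕ.0<1+n
        (trans y≡last (sym (relabel-> c))) (trans x≡0 (sym (relabel-≤ z≤n))) (inj₂ (≡.refl , ≡.refl)))
    edge⇒adj x y (inj₁ xy) = parent⇒adj (toℕ y) ≡.refl xy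
      where
      parent⇒adj : ∀ t → toℕ y ≡ t → Parent (toℕ x) t → Adj x y
      -- The label of the child tells which cycle provides the edge: below `m` it is C_m, from `m`
      -- onwards C_n.
      parent⇒adj (suc t) y≡ e with ℕ.<-cmp (suc t) m
      ... | tri< t<m t≢m _ =
        nextₘ⇒adj {x} {y} {t} {suc t} (ℕ.<⇒≤ t<m) t<m (trans (sym e) (par-suc t t≢m)) y≡ (inj₁ ≡.refl)
      ... | tri≈ _ ≡.refl _ =
        nextₙ⇒adj {x} {y} {p} {suc p} (s≤s (ℕ.m≤n+m p (suc c))) (s≤s (s≤s (ℕ.m≤n+m p c)))
          (trans (sym e) (trans par-m (sym (relabel-≤ ℕ.≤-refl)))) (trans y≡ (sym (relabel-> 0))) (inj₁ ≡.refl)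
      ... | tri> _ t≢m (s≤s m≤t) =
        nextₙ⇒adj {x} {y} {suc (d + p)} {suc (suc d + p)} (ℕ.<-trans ℕ.≤-refl d<n) d<n
          (trans (sym e) (trans (par-suc t t≢m) (trans t≡ (sym (relabel-> d)))))
          (trans y≡ (trans (cong suc t≡) (sym (relabel-> (suc d))))) (inj₁ ≡.refl)
        where
        d : ℕ
        d = t ∸ m
        t≡ : t ≡ d + m
        t≡ = sym (ℕ.m∸n+n≡m m≤t)
        d<c : d < c
        d<c = ℕ.+-cancelʳ-< m d c (ℕ.s≤s⁻¹ (subst (_≤ suc last) (cong suc (trans y≡ (cong suc t≡))) (subst (toℕ y <_) order≡last (toℕ<n y))))
        d<n : suc (suc d + p) < n
        d<n = s≤s (s≤s (ℕ.+-monoˡ-≤ p d<c))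

    joined⇒adj : ∀ x y → Joined (toℕ x) (toℕ y) → Adj x y
    joined⇒adj x y (inj₁ xy) = edge⇒adj x y xy
    joined⇒adj x y (inj₂ yx) = Graph.sym graph {y} {x} (edge⇒adj y x yx)

-- Counting edges: degrees and rank.

module Counting {c ℓ} (S : Semiring c ℓ) where
  open Semiring S hiding (zero)
  open SumProperties S
  open Indicator S
  open Algebra.Properties.Semiring.Mult S using () renaming (_×_ to _·_)

  -- Over a semiring, so that the same count serves `size` in ℕ and degrees in the ring.
  length-filter-tabulate : ∀ {a p} {A : Set a} {P : Pred A p} (P? : Decidable P) {n} (f : Fin n → A) →
    length (filter P? (tabulate f)) · 1# ≈ sum (λ i → [ P? (f i) ])
  length-filter-tabulate P? {zero}  f = refl
  length-filter-tabulate P? {suc n} f with does (P? (f zero))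
  ... | true  = +-congˡ (length-filter-tabulate P? (f ∘ suc))
  ... | false = trans (length-filter-tabulate P? (f ∘ suc)) (sym (+-identityˡ _))

module ℕSum = SumProperties ℕ.+-*-semiring
module ℕIndicator = Indicator ℕ.+-*-semiring

×1≡id : ∀ n → Algebra.Properties.Semiring.Mult._×_ ℕ.+-*-semiring n 1 ≡ n
×1≡id zero    = ≡.refl
×1≡id (suc n) = cong suc (×1≡id n)

length-filter-map : ∀ {a b p} {A : Set a} {B : Set b} {P : Pred B p} (P? : Decidable P) (f : A → B) xs →
  length (filter P? (List.map f xs)) ≡ length (filter (P? ∘ f) xs)
length-filter-map P? f List.[]       = ≡.refl
length-filter-map P? f (x List.∷ xs) with does (P? (f x))
... | true  = cong suc (length-filter-map P? f xs)
... | false = length-filter-map P? f xs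

length-filter-product : ∀ {a b p} {A : Set a} {B : Set b} {P : Pred (A Product.× B) p} (P? : Decidable P) {m n}
  (f : Fin m → A) (g : Fin n → B) →
  length (filter P? (cartesianProduct (tabulate f) (tabulate g)))
  ≡ ℕSum.sum (λ i → ℕSum.sum (λ j → ℕIndicator.[ P? (f i , g j) ]))
length-filter-product P? {zero}  f g = ≡.refl
length-filter-product P? {suc m} f g = begin
  length (filter P? (row List.++ rest))                  ≡⟨ cong length (filter-++ P? row rest) ⟩
  length (filter P? row List.++ filter P? rest)          ≡⟨ length-++ (filter P? row) ⟩
  length (filter P? row) ℕ.+ length (filter P? rest)
    ≡⟨ ≡.cong₂ ℕ._+_ count-row (length-filter-product P? (f ∘ suc) g) ⟩
  _                                                      ∎
  where
  open ≡.≡-Reasoning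
  row  = List.map (f zero ,_) (tabulate g)
  rest = cartesianProduct (tabulate (f ∘ suc)) (tabulate g)
  count-row : length (filter P? row) ≡ ℕSum.sum (λ j → ℕIndicator.[ P? (f zero , g j) ])
  count-row = begin
    length (filter P? row)
      ≡⟨ length-filter-map P? (f zero ,_) (tabulate g) ⟩
    length (filter (λ y → P? (f zero , y)) (tabulate g))        ≡⟨ ×1≡id _ ⟨
    _
      ≡⟨ Counting.length-filter-tabulate ℕ.+-*-semiring (λ y → P? (f zero , y)) g ⟩
    ℕSum.sum (λ j → ℕIndicator.[ P? (f zero , g j) ])           ∎

module EdgeSums {c ℓ} (S : Semiring c ℓ) (p b d : ℕ) (0<p : 0 < p) where
  open Semiring S hiding (zero)
  open SumProperties S
  open Indicator S
  open SpanningTree p b d 0<p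
  open Relation.Binary.Reasoning.Setoid setoid

  edge-indicator : ∀ x y → [ edge? x y ] ≈ [ parent? x y ] + δ x 0 * (δ y a + δ y last)
  edge-indicator x y = begin
    [ edge? x y ]
      ≈⟨ []-⊎ (parent? x y) (extra? x y) (parent-extra-disjoint x y) ⟩
    [ parent? x y ] + [ extra? x y ]
      ≈⟨ +-congˡ ([]-× (x ℕ.≟ 0) ((y ℕ.≟ a) ⊎-dec (y ℕ.≟ last))) ⟩
    [ parent? x y ] + δ x 0 * [ (y ℕ.≟ a) ⊎-dec (y ℕ.≟ last) ]
      ≈⟨ +-congˡ (*-congˡ ([]-⊎ (y ℕ.≟ a) (y ℕ.≟ last) λ (e , f) → ℕ.<⇒≢ a<last (≡.trans (≡.sym e) f))) ⟩
    [ parent? x y ] + δ x 0 * (δ y a + δ y last)                  ∎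

  sum-parent : ∀ {N} y → y < N → sum {N} (λ x → [ parent? (toℕ x) y ]) ≈ [ 0 ℕ.<? y ]
  sum-parent {N} zero    _   = sum-zero {N} _ λ _ → refl
  sum-parent {N} (suc y) y<N = begin
    sum {N} (λ x → δ (par (suc y)) (toℕ x))         ≈⟨ sum-cong-≋ {N} (λ x → sym (*-identityʳ _)) ⟩
    sum {N} (λ x → δ (par (suc y)) (toℕ x) * 1#)    ≈⟨ sum-δ (ℕ.≤-<-trans (par≤ y) (ℕ.<⇒≤ y<N)) (λ _ → 1#) ⟩
    1#                                              ∎

  sum-edge-below : ∀ {N} y → y < N →
    sum {N} (λ x → [ edge? (toℕ x) y ]) ≈ [ 0 ℕ.<? y ] + (δ y a + δ y last)
  sum-edge-below {N} y y<N = begin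
    sum {N} (λ x → [ edge? (toℕ x) y ])
      ≈⟨ sum-cong-≋ {N} (λ x → edge-indicator (toℕ x) y) ⟩
    sum {N} (λ x → [ parent? (toℕ x) y ] + δ (toℕ x) 0 * (δ y a + δ y last))
      ≈⟨ ∑-distrib-+ {N} _ _ ⟩
    sum {N} (λ x → [ parent? (toℕ x) y ]) + sum {N} (λ x → δ (toℕ x) 0 * (δ y a + δ y last))
      ≈⟨ +-cong (sum-parent y y<N) (trans (sum-cong-≋ {N} λ x → *-congʳ (δ-sym (toℕ x) 0)) (sum-δ (ℕ.≤-<-trans z≤n y<N) (λ _ → δ y a + δ y last))) ⟩
    [ 0 ℕ.<? y ] + (δ y a + δ y last)                                                   ∎

  module _ (m> : (p ℕ.+ 1) ⊔ 2 < m) (n> : (p ℕ.+ 1) ⊔ 2 < n) where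
    open Adjacency m> n>
    open Glue m n p m> n> using (graph; order)
    open Graph graph using (adj?)

    adj-indicator : ∀ x y → [ adj? x y ] ≈ [ edge? (toℕ x) (toℕ y) ] + [ edge? (toℕ y) (toℕ x) ]
    adj-indicator x y = trans
      (reflexive ([]-cong (adj? x y) (edge? (toℕ x) (toℕ y) ⊎-dec edge? (toℕ y) (toℕ x)) (adj⇒joined x y) (joined⇒adj x y)))
      ([]-⊎ (edge? (toℕ x) (toℕ y)) (edge? (toℕ y) (toℕ x)) λ (e , f) → ℕ.<-asym (edge⇒< e) (edge⇒< f))

module Rank (p b d : ℕ) (0<p : 0 < p) where
  open SpanningTree p b d 0<p
  open SumProperties ℕ.+-*-semiring
  open Indicator ℕ.+-*-semiring
  open EdgeSums ℕ.+-*-semiring p b d 0<p using (sum-edge-below)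

  sum-positive : ∀ k → sum {k} (λ y → [ 0 ℕ.<? toℕ y ]) ≡ k ∸ 1
  sum-positive zero    = ≡.refl
  sum-positive (suc k) = ≡.trans (sum-replicate k) (×1≡id k)

  module _ (m> : (p ℕ.+ 1) ⊔ 2 < m) (n> : (p ℕ.+ 1) ⊔ 2 < n) where
    open Adjacency m> n>
    open Glue m n p m> n> using (graph; order)
    open Graph graph using (adj?; size; rank)

    last<order : last < order
    last<order = subst (last <_) (≡.sym order≡last) ℕ.≤-refl

    size≡ : size ≡ order ∸ 1 ℕ.+ 2
    size≡ = begin
      size
        ≡⟨ length-filter-product _ {order} {order} id id ⟩
      sum (λ i → sum (λ j → [ (i Fin.<? j) ×-dec adj? i j ]))
        -- With the larger endpoint outside, the inner sum counts smaller neighbours: one parent for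
        -- each vertex except the root, and the root once more for `a` and for `last`.
        ≡⟨ ∑-comm {order} {order} (λ i j → [ (i Fin.<? j) ×-dec adj? i j ]) ⟩
      sum (λ j → sum (λ i → [ (i Fin.<? j) ×-dec adj? i j ]))
        ≡⟨ sum-cong-≋ {order} (λ j → sum-cong-≋ {order} λ i →
             []-cong ((i Fin.<? j) ×-dec adj? i j) (edge? (toℕ i) (toℕ j))
               (below i j) λ ij → edge⇒< ij , edge⇒adj i j ij) ⟩
      sum {order} (λ j → sum {order} (λ i → [ edge? (toℕ i) (toℕ j) ]))
        ≡⟨ sum-cong-≋ {order} (λ j → sum-edge-below (toℕ j) (toℕ<n j)) ⟩
      sum {order} (λ j → [ 0 ℕ.<? toℕ j ] ℕ.+ (δ (toℕ j) a ℕ.+ δ (toℕ j) last))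
        ≡⟨ ≡.trans (∑-distrib-+ {order} _ _) (≡.cong₂ ℕ._+_ (sum-positive order)
             (≡.trans (∑-distrib-+ {order} _ _) (≡.cong₂ ℕ._+_ (sum-δ-1 (ℕ.<-trans a<last last<order)) (sum-δ-1 last<order)))) ⟩
      order ∸ 1 ℕ.+ 2                                                    ∎
      where
      open ≡.≡-Reasoning
      below : ∀ i j → toℕ i < toℕ j Product.× Graph.Adj graph i j → Edge (toℕ i) (toℕ j)
      below i j (i<j , ij) with adj⇒joined i j ij
      ... | inj₁ e = e
      ... | inj₂ e = contradiction (edge⇒< e) (ℕ.<-asym i<j)

    rank≡2 : rank ≡ 2
    rank≡2 = ≡.trans (cong (λ z → z ℕ.+ 1 ∸ order) size≡) (positive (ℕ.≤-<-trans z≤n last<order))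
      where
      positive : ∀ {k} → 0 < k → k ∸ 1 ℕ.+ 2 ℕ.+ 1 ∸ k ≡ 2
      positive {suc k} _ = ≡.trans (cong (_∸ suc k) (≡.trans (ℕ.+-assoc k 2 1) (ℕ.+-suc k 2))) (ℕ.m+n∸m≡n (suc k) 2)

-- Polynomial identities behind the formula.

module ThetaPolynomial {c ℓ} (R : CommutativeRing c ℓ) where
  open CommutativeRing R hiding (zero)
  open Algebra.Properties.Ring ring
  open Algebra.Properties.Semiring.Exp semiring
  open Algebra.Properties.Semiring.Mult semiring using () renaming (_×_ to infixr 8 _·_)
  open RingSolver R
  open ColumnOperations R

  -- The polynomial for which (1 - u²) det (I + K C) is Φ at Γ = (1 - u²) γ,
  -- Δ = (1 - u²) δ and Ε = (1 - u²) ε, where K has the rows (u², -u, -u),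
  -- (-u, u², 0), (-u, 0, u²) and C is symmetric with the rows (1, α, β),
  -- (α, γ, ε), (β, ε, δ). It exists because the coefficient of γ δ - ε² in the
  -- determinant is divisible by 1 - u².
  Φ : (u α β Γ Δ Ε : Carrier) → Carrier
  Φ u α β Γ Δ Ε =
    let u² = u * u
        q  = 1# - u²
    in q * (1# + u² - (u + u) * (α + β) + u² * q * (α * α + β * β) + (u² + u²) * α * β)
       + Γ * (u² * (u² - (u + u) * β + u² * (1# + q) * β * β))
       + Δ * (u² * (u² - (u + u) * α + u² * (1# + q) * α * α))
       + Ε * ((u² + u²) * (u * (α + β) - 1# - u² * (1# + q) * α * β))
       - u² * u² * (Γ * Δ - Ε * Ε)

  Φ-cong : ∀ u α β {Γ Γ′ Δ Δ′ Ε Ε′} → Γ ≈ Γ′ → Δ ≈ Δ′ → Ε ≈ Ε′ → Φ u α β Γ Δ Ε ≈ Φ u α β Γ′ Δ′ Ε′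
  Φ-cong u α β Γ≈ Δ≈ Ε≈ =
    //-cong₂ (+-cong (+-cong (+-congˡ (*-congʳ Γ≈)) (*-congʳ Δ≈)) (*-congʳ Ε≈))
             (*-congˡ (//-cong₂ (*-cong Γ≈ Δ≈) (*-cong Ε≈ Ε≈)))

  :Φ : ∀ {n} (u α β Γ Δ Ε : Polynomial n) → Polynomial n
  :Φ u α β Γ Δ Ε =
    let u² = u :* u
        q  = :1 :- u²
    in q :* (:1 :+ u² :- (u :+ u) :* (α :+ β) :+ u² :* q :* (α :* α :+ β :* β) :+ (u² :+ u²) :* α :* β)
       :+ Γ :* (u² :* (u² :- (u :+ u) :* β :+ u² :* (:1 :+ q) :* β :* β))
       :+ Δ :* (u² :* (u² :- (u :+ u) :* α :+ u² :* (:1 :+ q) :* α :* α))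
       :+ Ε :* ((u² :+ u²) :* (u :* (α :+ β) :- :1 :- u² :* (:1 :+ q) :* α :* β))
       :- u² :* u² :* (Γ :* Δ :- Ε :* Ε)

  -- The matrix I + K C of the comment on `Φ`, left unsimplified to match the shape in which
  -- `det-three-rows` delivers its entries; the factors `1#` are the value of `green` at the root.
  entries : (u α β γ δ ε : Carrier) → Fin 3 → Fin 3 → Carrier
  entries u α β γ δ ε =
    let u² = u * u in
    ⟨ ⟨ 1# + (u² * 1# - u * α - u * β) , 0# + (u² * α - u * γ - u * ε) , 0# + (u² * β - u * ε - u * δ) ⟩
    , ⟨ 0# + (u² * α - u * 1#)         , 1# + (u² * γ - u * α)         , 0# + (u² * ε - u * β) ⟩
    , ⟨ 0# + (u² * β - u * 1#)         , 0# + (u² * ε - u * α)         , 1# + (u² * δ - u * β) ⟩ ⟩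

  -- By the Cauchy-Binet formula, γ δ - ε² has as coefficient det K plus the minor u⁴ of K at the
  -- last two sites: u⁶ - 2u⁴ + u⁴ = -u⁴ (1 - u²). This is the last term of `Φ`.
  det-entries : ∀ u α β γ δ ε → let q = 1# - u * u in
    q * det₃ (entries u α β γ δ ε) ≈ Φ u α β (q * γ) (q * δ) (q * ε)
  det-entries = solve 6 (λ u α β γ δ ε →
    let u²  = u :* u
        q   = :1 :- u²
        x₀₀ = :1 :+ (u² :* :1 :- u :* α :- u :* β)
        x₀₁ = :0 :+ (u² :* α :- u :* γ :- u :* ε)
        x₀₂ = :0 :+ (u² :* β :- u :* ε :- u :* δ)
        x₁₀ = :0 :+ (u² :* α :- u :* :1)
        x₁₁ = :1 :+ (u² :* γ :- u :* α)
        x₁₂ = :0 :+ (u² :* ε :- u :* β)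
        x₂₀ = :0 :+ (u² :* β :- u :* :1)
        x₂₁ = :0 :+ (u² :* ε :- u :* α)
        x₂₂ = :1 :+ (u² :* δ :- u :* β)
    in q :* (x₀₀ :* (x₁₁ :* x₂₂ :- x₁₂ :* x₂₁) :- x₀₁ :* (x₁₀ :* x₂₂ :- x₁₂ :* x₂₀) :+ x₀₂ :* (x₁₀ :* x₂₁ :- x₁₁ :* x₂₀))
       := :Φ u α β (q :* γ) (q :* δ) (q :* ε)) refl

  -- `s`, `A` and `B` stand for the powers of u with exponents p, b and d. As independent
  -- indeterminates they leave only numerals in the exponents, which the solver requires.
  Φ-expanded : ∀ u s A B →
    let monomial = λ i j k l → s ^ i * u ^ j * (A ^ k * B ^ l)
        α = s * u * A
        β = s * u * B
    in Φ u α β (1# - u * u * α * α) (1# - u * u * β * β) (u * u * A * B * (1# - u * u * s * s))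
       ≈ - (4 · monomial 2 8 2 2) + monomial 0 8 2 2 + 2 · monomial 1 6 1 2 + 2 · monomial 1 6 2 1
         + monomial 2 4 0 2 + monomial 2 4 2 0 + 2 · monomial 2 4 1 1
         - 2 · monomial 0 4 1 1 - 2 · monomial 1 2 0 1 - 2 · monomial 1 2 1 0 + 1#
  Φ-expanded = solve 4 (λ u s A B →
    let monomial = λ i j k l → s :^ i :* u :^ j :* (A :^ k :* B :^ l)
        α = s :* u :* A
        β = s :* u :* B
    in :Φ u α β (:1 :- u :* u :* α :* α) (:1 :- u :* u :* β :* β) (u :* u :* A :* B :* (:1 :- u :* u :* s :* s))
       := :- (4 :× monomial 2 8 2 2) :+ monomial 0 8 2 2 :+ 2 :× monomial 1 6 1 2 :+ 2 :× monomial 1 6 2 1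
          :+ monomial 2 4 0 2 :+ monomial 2 4 2 0 :+ 2 :× monomial 2 4 1 1
          :- 2 :× monomial 0 4 1 1 :- 2 :× monomial 1 2 0 1 :- 2 :× monomial 1 2 1 0 :+ :1) refl

module Exponents (p b d : ℕ) where
  open +-*-Solver

  m n : ℕ
  m = suc (suc (b ℕ.+ p))
  n = suc (suc (d ℕ.+ p))

  exponent : (i j k l : ℕ) → ℕ
  exponent i j k l = p ℕ.* i ℕ.+ j ℕ.+ (b ℕ.* k ℕ.+ d ℕ.* l)

  private
    :C : ∀ {v} → Polynomial v → Polynomial v → Polynomial v
    :C p b = con 2 :+ (b :+ p)

    :E : ∀ {v} (p b d : Polynomial v) (i j k l : ℕ) → Polynomial v
    :E p b d i j k l = p :* con i :+ con j :+ (b :* con k :+ d :* con l)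

    -- Each subtrahend in an exponent is exhibited as a summand, so the truncated subtraction is
    -- exact.
    cancel : ∀ {x y} z → x ≡ y ℕ.+ z → x ∸ z ≡ y
    cancel {y = y} z ≡.refl = ℕ.m+n∸n≡m y z

  2m+2n-2p : 2 ℕ.* m ℕ.+ 2 ℕ.* n ∸ 2 ℕ.* p ≡ exponent 2 8 2 2
  2m+2n-2p = cancel (2 ℕ.* p) (solve 3 (λ p b d →
    con 2 :* :C p b :+ con 2 :* :C p d := :E p b d 2 8 2 2 :+ con 2 :* p) ≡.refl p b d)

  2m+2n-4p : 2 ℕ.* m ℕ.+ 2 ℕ.* n ∸ 4 ℕ.* p ≡ exponent 0 8 2 2
  2m+2n-4p = cancel (4 ℕ.* p) (solve 3 (λ p b d →
    con 2 :* :C p b :+ con 2 :* :C p d := :E p b d 0 8 2 2 :+ con 4 :* p) ≡.refl p b d)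

  m+2n-2p : m ℕ.+ 2 ℕ.* n ∸ 2 ℕ.* p ≡ exponent 1 6 1 2
  m+2n-2p = cancel (2 ℕ.* p) (solve 3 (λ p b d →
    :C p b :+ con 2 :* :C p d := :E p b d 1 6 1 2 :+ con 2 :* p) ≡.refl p b d)

  2m+n-2p : 2 ℕ.* m ℕ.+ n ∸ 2 ℕ.* p ≡ exponent 1 6 2 1
  2m+n-2p = cancel (2 ℕ.* p) (solve 3 (λ p b d →
    con 2 :* :C p b :+ :C p d := :E p b d 1 6 2 1 :+ con 2 :* p) ≡.refl p b d)

  2n : 2 ℕ.* n ≡ exponent 2 4 0 2
  2n = solve 3 (λ p b d → con 2 :* :C p d := :E p b d 2 4 0 2) ≡.refl p b d

  2m : 2 ℕ.* m ≡ exponent 2 4 2 0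
  2m = solve 3 (λ p b d → con 2 :* :C p b := :E p b d 2 4 2 0) ≡.refl p b d

  m+n : m ℕ.+ n ≡ exponent 2 4 1 1
  m+n = solve 3 (λ p b d → :C p b :+ :C p d := :E p b d 2 4 1 1) ≡.refl p b d

  m+n-2p : m ℕ.+ n ∸ 2 ℕ.* p ≡ exponent 0 4 1 1
  m+n-2p = cancel (2 ℕ.* p) (solve 3 (λ p b d →
    :C p b :+ :C p d := :E p b d 0 4 1 1 :+ con 2 :* p) ≡.refl p b d)

  n≡ : n ≡ exponent 1 2 0 1
  n≡ = solve 3 (λ p b d → :C p d := :E p b d 1 2 0 1) ≡.refl p b d

  m≡ : m ≡ exponent 1 2 1 0
  m≡ = solve 3 (λ p b d → :C p b := :E p b d 1 2 1 0) ≡.refl p b d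

-- Evaluation for the glued cycles.

module ThetaDeterminant {c ℓ} (R : CommutativeRing c ℓ) (u : CommutativeRing.Carrier R)
                        (p b d : ℕ) (0<p : 0 < p) where
  open SpanningTree p b d 0<p
  open Exponents p b d hiding (m; n)
  open CommutativeRing R hiding (zero)
  open Algebra.Properties.Ring ring
  open Algebra.Properties.Semiring.Exp semiring
  open SumProperties semiring
  open Indicator semiring
  open EdgeSums semiring p b d 0<p
  open Counting semiring
  open Algebra.Properties.Semiring.Mult semiring using (×-congʳ) renaming (_×_ to infixr 8 _·_)
  open ThetaPolynomial R
  open RingSolver R
  open Determinant R using (det-cong)
  open ColumnOperations R
  open RootedTree R u par par≤
  open Zeta R using (Matrix; det; I; 𝓐; 𝓠; ζ⁻¹)
  open Relation.Binary.Reasoning.Setoid setoid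

  climb : ∀ (Y : ℕ → Carrier) s e → (∀ t → s ≤ t → Y (suc t) ≈ u * Y (par (suc t))) →
          e ℕ.+ s < m → Y (e ℕ.+ s) ≈ u ^ e * Y s
  climb Y s zero    _    _    = sym (*-identityˡ _)
  climb Y s (suc e) step e<m = begin
    Y (suc (e ℕ.+ s))                 ≈⟨ step (e ℕ.+ s) (ℕ.m≤n+m s e) ⟩
    u * Y (par (suc (e ℕ.+ s)))       ≡⟨ cong (λ z → u * Y z) (par-suc _ (ℕ.<⇒≢ e<m)) ⟩
    u * Y (e ℕ.+ s)                   ≈⟨ *-congˡ (climb Y s e step (ℕ.<⇒≤ e<m)) ⟩
    u * (u ^ e * Y s)                 ≈⟨ *-assoc _ _ _ ⟨
    u * u ^ e * Y s                   ∎

  -- The branch of C_n hangs from `p`, not from `m` - 1; the edge from `p` to `m` accounts for the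
  -- additional factor `u`.
  climb-branch : ∀ (Y : ℕ → Carrier) e → (∀ t → a ≤ t → Y (suc t) ≈ u * Y (par (suc t))) →
                 Y (e ℕ.+ m) ≈ u ^ suc e * Y p
  climb-branch Y zero    step = begin
    Y m               ≈⟨ step a ℕ.≤-refl ⟩
    u * Y (par m)     ≡⟨ cong (λ z → u * Y z) par-m ⟩
    u * Y p           ≈⟨ *-congʳ (*-identityʳ u) ⟨
    u * 1# * Y p      ∎
  climb-branch Y (suc e) step = begin
    Y (suc (e ℕ.+ m))             ≈⟨ step (e ℕ.+ m) (ℕ.<⇒≤ (ℕ.m≤n+m m e)) ⟩
    u * Y (par (suc (e ℕ.+ m)))   ≡⟨ cong (λ z → u * Y z) (par-suc _ (ℕ.>⇒≢ (s≤s (ℕ.m≤n+m m e)))) ⟩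
    u * Y (e ℕ.+ m)               ≈⟨ *-congˡ (climb-branch Y e step) ⟩
    u * (u ^ suc e * Y p)         ≈⟨ *-assoc _ _ _ ⟨
    u * u ^ suc e * Y p           ∎

  s A B : Carrier
  s = u ^ p
  A = u ^ b
  B = u ^ d

  W-p : W 0 p ≈ s
  W-p = begin
    W 0 p              ≡⟨ cong (W 0) (ℕ.+-identityʳ p) ⟨
    W 0 (p ℕ.+ 0)      ≈⟨ climb (W 0) 0 p (λ t _ → W-root t) (subst (_< m) (≡.sym (ℕ.+-identityʳ p)) p<m) ⟩
    s * 1#             ≈⟨ *-identityʳ s ⟩
    s                  ∎

  W-a : W 0 a ≈ s * u * A
  W-a = begin
    W 0 a              ≈⟨ climb (W 0) p (suc b) (λ t _ → W-root t) ℕ.≤-refl ⟩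
    u * A * W 0 p      ≈⟨ *-congˡ W-p ⟩
    u * A * s          ≈⟨ solve 3 (λ u s A → u :* A :* s := s :* u :* A) refl u s A ⟩
    s * u * A          ∎

  W-last : W 0 last ≈ s * u * B
  W-last = begin
    W 0 last           ≈⟨ climb-branch (W 0) d (λ t _ → W-root t) ⟩
    u * B * W 0 p      ≈⟨ *-congˡ W-p ⟩
    u * B * s          ≈⟨ solve 3 (λ u s B → u :* B :* s := s :* u :* B) refl u s B ⟩
    s * u * B          ∎

  -- The lowest common ancestor of `a` and `last` is `p`, at distances `b` + 1 and `d` + 1. Moving
  -- either argument up to `p` gives only powers of `u`, since the term of `W` in the recursion
  -- vanishes until the two vertices meet.
  green-a-last : (1# - u * u) * green a last ≈ u * u * A * B * (1# - u * u * s * s)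
  green-a-last = begin
    (1# - u * u) * green a last
      ≈⟨ *-congˡ (climb-branch (green a) d λ t a≤t → drop (green-suc′ a t) (W-zero (suc t) a (s≤s a≤t))) ⟩
    (1# - u * u) * (u * B * green a p)
      ≈⟨ *-congˡ (*-congˡ (climb (λ k → green k p) p (suc b) (λ t p≤t → drop (green-suc t p) (W-zero (suc t) p (s≤s p≤t))) ℕ.≤-refl)) ⟩
    (1# - u * u) * (u * B * (u * A * green p p))
      ≈⟨ solve 4 (λ u A B g →
           (:1 :- u :* u) :* (u :* B :* (u :* A :* g))
           := u :* u :* A :* B :* ((:1 :- u :* u) :* g)) refl u A B (green p p) ⟩
    u * u * A * B * ((1# - u * u) * green p p)
      ≈⟨ *-congˡ (green-diagonal p) ⟩
    u * u * A * B * (1# - u * u * W 0 p * W 0 p)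
      ≈⟨ *-congˡ (+-congˡ (-‿cong (*-cong (*-congˡ W-p) W-p))) ⟩
    u * u * A * B * (1# - u * u * s * s)  ∎
    where
    drop : ∀ {x y z} → x ≈ y + z → y ≈ 0# → x ≈ z
    drop x≈ y≈0 = trans x≈ (trans (+-congʳ y≈0) (+-identityˡ _))

  P-parent : ∀ k j → P k j ≡ [ parent? j k ]
  P-parent zero    j = ≡.refl
  P-parent (suc k) j = ≡.refl

  P-idem : ∀ k j → P k j * P k j ≈ P k j
  P-idem zero    j = zeroˡ 0#
  P-idem (suc k) j = δ-idem (par (suc k)) j

  P-disjoint : ∀ k {i j} → i ≢ j → P k i * P k j ≈ 0#
  P-disjoint zero    _   = zeroˡ 0#
  P-disjoint (suc k) {i} {j} i≢j = trans (*-cong (δ-sym (par (suc k)) i) (δ-sym (par (suc k)) j)) (δ-disjoint (par (suc k)) i≢j)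

  module _ (m> : (p ℕ.+ 1) ⊔ 2 < m) (n> : (p ℕ.+ 1) ⊔ 2 < n) where
    open Adjacency m> n>
    open Glue m n p m> n> using (graph; order)
    open Graph graph using (adj?; degree)
    open Rank p b d 0<p using (rank≡2; last<order)

    0<order : 0 < order
    0<order = ℕ.≤-<-trans z≤n (last<order m> n>)

    a<order : a < order
    a<order = ℕ.<-trans a<last (last<order m> n>)

    site : Fin 3 → Fin order
    site 0F = fromℕ< 0<order
    site 1F = fromℕ< a<order
    site 2F = fromℕ< (last<order m> n>)

    siteℕ : Fin 3 → ℕ
    siteℕ 0F = 0
    siteℕ 1F = a
    siteℕ 2F = last

    toℕ-site : ∀ r → toℕ (site r) ≡ siteℕ r
    toℕ-site 0F = toℕ-fromℕ< 0<order
    toℕ-site 1F = toℕ-fromℕ< a<order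
    toℕ-site 2F = toℕ-fromℕ< (last<order m> n>)

    site-injective : ∀ {r t} → site r ≡ site t → r ≡ t
    site-injective {r} {t} e = siteℕ-injective r t (≡.trans (≡.sym (toℕ-site r)) (≡.trans (cong toℕ e) (toℕ-site t)))
      where
      0<last : 0 < last
      0<last = ℕ.≤-<-trans z≤n a<last
      siteℕ-injective : ∀ r t → siteℕ r ≡ siteℕ t → r ≡ t
      siteℕ-injective 0F 0F _ = ≡.refl
      siteℕ-injective 0F 2F f = contradiction f (ℕ.<⇒≢ 0<last)
      siteℕ-injective 1F 1F _ = ≡.refl
      siteℕ-injective 1F 2F f = contradiction f (ℕ.<⇒≢ a<last)
      siteℕ-injective 2F 0F f = contradiction f (ℕ.>⇒≢ 0<last)
      siteℕ-injective 2F 1F f = contradiction f (ℕ.>⇒≢ a<last)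
      siteℕ-injective 2F 2F _ = ≡.refl

    open ThreeRows site site-injective using (rows; det-three-rows)

    -- The nonzero rows of `K`: -u for the two edges outside the tree, and u² on the diagonal at all
    -- three sites.
    κ : Fin 3 → ℕ → Carrier
    κ 0F j = u * u * δ 0 j - u * δ a j - u * δ last j
    κ 1F j = u * u * δ a j - u * δ 0 j
    κ 2F j = u * u * δ last j - u * δ 0 j

    K : Matrix order
    K i j = sum (λ r → κ r (toℕ j) * identity i (site r))


    -- First the larger neighbours: the children and, for the root, `a` and `last`. Then the smaller
    -- ones: the parent and, for `a` and `last`, the root.
    degree≈ : ∀ i → let x = toℕ i in
      degree i · 1# ≈ (sum {order} (λ k → P (toℕ k) x) + δ x 0 * (1# + 1#)) + ((1# - δ x 0) + (δ x a + δ x last))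
    degree≈ i = begin
      degree i · 1#
        ≈⟨ length-filter-tabulate (adj? i) {order} id ⟩
      sum (λ j → [ adj? i j ])
        ≈⟨ sum-cong-≋ {order} (adj-indicator m> n> i) ⟩
      sum {order} (λ j → [ edge? x (toℕ j) ] + [ edge? (toℕ j) x ])     ≈⟨ ∑-distrib-+ {order} _ _ ⟩
      sum {order} (λ j → [ edge? x (toℕ j) ]) + sum {order} (λ j → [ edge? (toℕ j) x ])
        ≈⟨ +-cong above (trans (sum-edge-below x (toℕ<n i)) (+-congʳ (positive x))) ⟩
      _                                                                 ∎
      where
      x = toℕ i
      positive : ∀ x → [ 0 ℕ.<? x ] ≈ 1# - δ x 0
      positive zero    = sym (-‿inverseʳ 1#)
      positive (suc x) = sym (trans (+-congˡ -0#≈0#) (+-identityʳ 1#))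
      above : sum {order} (λ j → [ edge? x (toℕ j) ]) ≈ sum {order} (λ k → P (toℕ k) x) + δ x 0 * (1# + 1#)
      above = begin
        sum {order} (λ j → [ edge? x (toℕ j) ])
          ≈⟨ sum-cong-≋ {order} (λ j → trans (edge-indicator x (toℕ j)) (+-congʳ (reflexive (≡.sym (P-parent (toℕ j) x))))) ⟩
        sum {order} (λ j → P (toℕ j) x + δ x 0 * (δ (toℕ j) a + δ (toℕ j) last))
          ≈⟨ ∑-distrib-+ {order} (λ j → P (toℕ j) x) (λ j → δ x 0 * (δ (toℕ j) a + δ (toℕ j) last)) ⟩
        sum {order} (λ j → P (toℕ j) x) + sum {order} (λ j → δ x 0 * (δ (toℕ j) a + δ (toℕ j) last))
          ≈⟨ +-congˡ (*-distribˡ-sum {order} (δ x 0) (λ j → δ (toℕ j) a + δ (toℕ j) last)) ⟨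
        sum {order} (λ j → P (toℕ j) x) + δ x 0 * sum {order} (λ j → δ (toℕ j) a + δ (toℕ j) last)
          ≈⟨ +-congˡ (*-congˡ (trans (∑-distrib-+ {order} _ _) (+-cong (sum-δ-1 a<order) (sum-δ-1 (last<order m> n>))))) ⟩
        sum {order} (λ j → P (toℕ j) x) + δ x 0 * (1# + 1#)  ∎

    𝓐≈ : ∀ i j → let x = toℕ i ; y = toℕ j in
      𝓐 graph i j ≈ (P y x + δ x 0 * (δ y a + δ y last)) + (P x y + δ y 0 * (δ x a + δ x last))
    𝓐≈ i j = trans (adj-indicator m> n> i j) (+-cong (half (toℕ i) (toℕ j)) (half (toℕ j) (toℕ i)))
      where
      half : ∀ x y → [ edge? x y ] ≈ P y x + δ x 0 * (δ y a + δ y last)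
      half x y = trans (edge-indicator x y) (+-congʳ (reflexive (≡.sym (P-parent y x))))

    K≈ : ∀ i j → let x = toℕ i ; y = toℕ j in
      K i j ≈ (u * u * δ y 0 - u * δ y a - u * δ y last) * δ x 0
              + ((u * u * δ y a - u * δ y 0) * δ x a + ((u * u * δ y last - u * δ y 0) * δ x last + 0#))
    K≈ i j = +-cong (*-cong (//-cong₂ (//-cong₂ (*-congˡ (δ-sym 0 y)) (*-congˡ (δ-sym a y))) (*-congˡ (δ-sym last y))) (at 0F))
            (+-cong (*-cong (//-cong₂ (*-congˡ (δ-sym a y)) (*-congˡ (δ-sym 0 y))) (at 1F))
             (+-congʳ (*-cong (//-cong₂ (*-congˡ (δ-sym last y)) (*-congˡ (δ-sym 0 y))) (at 2F))))
      where
      y = toℕ j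
      at : ∀ r → identity i (site r) ≈ δ (toℕ i) (siteℕ r)
      at r = reflexive (cong (δ (toℕ i)) (toℕ-site r))

    bass : Matrix order
    bass i j = I graph i j - 𝓐 graph i j * u + 𝓠 graph i j * u ^ 2

    bass≈tree+K : ∀ i j → bass i j ≈
      identity i j - u * (P (toℕ i) (toℕ j) + P (toℕ j) (toℕ i))
      + u * u * sum {order} (λ k → P (toℕ k) (toℕ i) * P (toℕ k) (toℕ j)) + K i j
    bass≈tree+K i j with i ≟ j
    ... | yes ≡.refl = begin
      1# - 𝓐 graph i i * u + (degree i · 1# - 1#) * u ^ 2
        ≈⟨ +-cong (+-congˡ (-‿cong (*-congʳ (𝓐≈ i i)))) (*-congʳ (+-congʳ (degree≈ i))) ⟩
      1# - ((P x x + d₀ * (dₐ + dₗ)) + (P x x + d₀ * (dₐ + dₗ))) * u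
        + ((S + d₀ * (1# + 1#)) + ((1# - d₀) + (dₐ + dₗ)) - 1#) * u ^ 2
        -- The root indicator survives once: 2 from the edges outside the tree, less 1 for the
        -- missing parent. At other vertices the parent cancels the 1 subtracted in `𝓠`.
        ≈⟨ solve 6 (λ u p s d₀ dₐ dₗ →
             :1 :- ((p :+ d₀ :* (dₐ :+ dₗ)) :+ (p :+ d₀ :* (dₐ :+ dₗ))) :* u
               :+ ((s :+ d₀ :* (:1 :+ :1)) :+ ((:1 :- d₀) :+ (dₐ :+ dₗ)) :- :1) :* u :^ 2
             := :1 :- u :* (p :+ p) :+ u :* u :* s
                :+ (u :* u :* (d₀ :+ dₐ :+ dₗ) :- (u :+ u) :* d₀ :* (dₐ :+ dₗ))) refl u (P x x) S d₀ dₐ dₗ ⟩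
      1# - u * (P x x + P x x) + u * u * S + (u * u * (d₀ + dₐ + dₗ) - (u + u) * d₀ * (dₐ + dₗ))
        -- Entries of Pᵀ P and `K` are sums of products of two indicators; on the diagonal these are
        -- squares, and indicators are idempotent.
        ≈⟨ +-cong (+-cong (+-congʳ (δ-≡ {x} ≡.refl)) (*-congˡ (sum-cong-≋ {order} λ k → P-idem (toℕ k) x)))
             (+-congʳ (*-congˡ (+-cong (+-cong (δ-idem x 0) (δ-idem x a)) (δ-idem x last)))) ⟨
      common + (u * u * (d₀ * d₀ + dₐ * dₐ + dₗ * dₗ) - (u + u) * d₀ * (dₐ + dₗ))
        ≈⟨ +-congˡ (solve 4 (λ u d₀ dₐ dₗ → u :* u :* (d₀ :* d₀ :+ dₐ :* dₐ :+ dₗ :* dₗ) :- (u :+ u) :* d₀ :* (dₐ :+ dₗ)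
             := (u :* u :* d₀ :- u :* dₐ :- u :* dₗ) :* d₀
                :+ ((u :* u :* dₐ :- u :* d₀) :* dₐ :+ ((u :* u :* dₗ :- u :* d₀) :* dₗ :+ :0))) refl u d₀ dₐ dₗ) ⟩
      _ ≈⟨ +-congˡ (K≈ i i) ⟨
      common + K i i  ∎
      where
      x = toℕ i
      d₀ = δ x 0
      dₐ = δ x a
      dₗ = δ x last
      S = sum {order} (λ k → P (toℕ k) x)
      common = identity i i - u * (P x x + P x x) + u * u * sum {order} (λ k → P (toℕ k) x * P (toℕ k) x)
    ... | no i≢j = begin
      0# - 𝓐 graph i j * u + (0# - 0#) * u ^ 2
        ≈⟨ +-congʳ (+-congˡ (-‿cong (*-congʳ (𝓐≈ i j)))) ⟩
      0# - ((P y x + d₀ * (eₐ + eₗ)) + (P x y + e₀ * (dₐ + dₗ))) * u + (0# - 0#) * u ^ 2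
        ≈⟨ solve 9 (λ u p p′ d₀ dₐ dₗ e₀ eₐ eₗ →
             :0 :- ((p′ :+ d₀ :* (eₐ :+ eₗ)) :+ (p :+ e₀ :* (dₐ :+ dₗ))) :* u :+ (:0 :- :0) :* u :^ 2
             := :0 :- u :* (p :+ p′) :+ u :* u :* :0 :+ (u :* u :* (:0 :+ :0 :+ :0) :- u :* (d₀ :* (eₐ :+ eₗ) :+ e₀ :* (dₐ :+ dₗ))))
             refl u (P x y) (P y x) d₀ dₐ dₗ e₀ eₐ eₗ ⟩
      0# - u * (P x y + P y x) + u * u * 0# + (u * u * (0# + 0# + 0#) - u * (d₀ * (eₐ + eₗ) + e₀ * (dₐ + dₗ)))
        -- The zeros kept in the previous line are products of indicators at two distinct vertices.
        ≈⟨ +-cong (+-cong (+-congʳ (identity-≢ i≢j)) (*-congˡ (sum-zero {order} _ λ k → P-disjoint (toℕ k) x≢y)))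
             (+-congʳ (*-congˡ (+-cong (+-cong (δ-disjoint 0 x≢y) (δ-disjoint a x≢y)) (δ-disjoint last x≢y)))) ⟨
      common + (u * u * (d₀ * e₀ + dₐ * eₐ + dₗ * eₗ) - u * (d₀ * (eₐ + eₗ) + e₀ * (dₐ + dₗ)))
        ≈⟨ +-congˡ (solve 7 (λ u d₀ dₐ dₗ e₀ eₐ eₗ →
             u :* u :* (d₀ :* e₀ :+ dₐ :* eₐ :+ dₗ :* eₗ) :- u :* (d₀ :* (eₐ :+ eₗ) :+ e₀ :* (dₐ :+ dₗ))
             := (u :* u :* e₀ :- u :* eₐ :- u :* eₗ) :* d₀
                :+ ((u :* u :* eₐ :- u :* e₀) :* dₐ :+ ((u :* u :* eₗ :- u :* e₀) :* dₗ :+ :0))) refl u d₀ dₐ dₗ e₀ eₐ eₗ) ⟩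
      _ ≈⟨ +-congˡ (K≈ i j) ⟨
      common + K i j  ∎
      where
      x = toℕ i
      y = toℕ j
      x≢y : x ≢ y
      x≢y = i≢j ∘ toℕ-injective
      d₀ = δ x 0
      dₐ = δ x a
      dₗ = δ x last
      e₀ = δ y 0
      eₐ = δ y a
      eₗ = δ y last
      common = identity i j - u * (P x y + P y x) + u * u * sum {order} (λ k → P (toℕ k) x * P (toℕ k) y)

    -- The site rows of K (Uᵀ U)⁻¹. The columns of `K` are supported on the sites too, so only three
    -- values of `green` enter.
    X : Fin 3 → ℕ → Carrier
    X 0F j = u * u * green j 0 - u * green j a - u * green j last
    X 1F j = u * u * green j a - u * green j 0
    X 2F j = u * u * green j last - u * green j 0

    sum-κ-green : ∀ r j → sum {order} (λ t → κ r (toℕ t) * green j (toℕ t)) ≈ X r j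
    sum-κ-green r j = trans (sum-cong-≋ {order} (split r ∘ toℕ)) (trans sum-sites (collect r))
      where
      weight : Fin 3 → Fin 3 → Carrier
      weight 0F = ⟨ u * u , - u , - u ⟩
      weight 1F = ⟨ - u , u * u , 0# ⟩
      weight 2F = ⟨ - u , 0# , u * u ⟩
      f : Fin 3 → ℕ → Carrier
      f e t = weight r e * green j t
      split : ∀ r t → κ r t * green j t ≈ δ 0 t * (weight r 0F * green j t) + (δ a t * (weight r 1F * green j t) + δ last t * (weight r 2F * green j t))
      split 0F t = solve 5 (λ u d₀ dₐ dₗ g → (u :* u :* d₀ :- u :* dₐ :- u :* dₗ) :* g
        := d₀ :* (u :* u :* g) :+ (dₐ :* (:- u :* g) :+ dₗ :* (:- u :* g))) refl u (δ 0 t) (δ a t) (δ last t) (green j t)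
      split 1F t = solve 5 (λ u d₀ dₐ dₗ g → (u :* u :* dₐ :- u :* d₀) :* g
        := d₀ :* (:- u :* g) :+ (dₐ :* (u :* u :* g) :+ dₗ :* (:0 :* g))) refl u (δ 0 t) (δ a t) (δ last t) (green j t)
      split 2F t = solve 5 (λ u d₀ dₐ dₗ g → (u :* u :* dₗ :- u :* d₀) :* g
        := d₀ :* (:- u :* g) :+ (dₐ :* (:0 :* g) :+ dₗ :* (u :* u :* g))) refl u (δ 0 t) (δ a t) (δ last t) (green j t)
      sum-sites : sum {order} (λ t → δ 0 (toℕ t) * f 0F (toℕ t) + (δ a (toℕ t) * f 1F (toℕ t) + δ last (toℕ t) * f 2F (toℕ t)))
                  ≈ f 0F 0 + (f 1F a + f 2F last)
      sum-sites = trans (∑-distrib-+ {order} (λ t → δ 0 (toℕ t) * f 0F (toℕ t)) _)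
        (+-cong (sum-δ 0<order (f 0F)) (trans (∑-distrib-+ {order} (λ t → δ a (toℕ t) * f 1F (toℕ t)) _)
          (+-cong (sum-δ a<order (f 1F)) (sum-δ (last<order m> n>) (f 2F)))))
      collect : ∀ r → weight r 0F * green j 0 + (weight r 1F * green j a + weight r 2F * green j last) ≈ X r j
      collect 0F = solve 4 (λ u g₀ gₐ gₗ →
           u :* u :* g₀ :+ (:- u :* gₐ :+ :- u :* gₗ)
           := u :* u :* g₀ :- u :* gₐ :- u :* gₗ) refl u _ _ _
      collect 1F = solve 4 (λ u g₀ gₐ gₗ →
           :- u :* g₀ :+ (u :* u :* gₐ :+ :0 :* gₗ)
           := u :* u :* gₐ :- u :* g₀) refl u _ _ _
      collect 2F = solve 4 (λ u g₀ gₐ gₗ →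
           :- u :* g₀ :+ (:0 :* gₐ :+ u :* u :* gₗ)
           := u :* u :* gₗ :- u :* g₀) refl u _ _ _

    K-green≈ : ∀ (i j : Fin order) → sum (λ t → K i t * green (toℕ j) (toℕ t)) ≈ sum (λ r → X r (toℕ j) * identity i (site r))
    K-green≈ i j = begin
      sum (λ t → K i t * g t)
        ≈⟨ sum-cong-≋ {order} (λ t → *-distribʳ-sum (g t) (λ r → κ r (toℕ t) * identity i (site r))) ⟩
      sum {order} (λ t → sum (λ r → κ r (toℕ t) * identity i (site r) * g t))
        ≈⟨ ∑-comm {order} {3} (λ t r → κ r (toℕ t) * identity i (site r) * g t) ⟩
      sum (λ r → sum (λ t → κ r (toℕ t) * identity i (site r) * g t))      ≈⟨ sum-cong-≋ {3} column≈ ⟩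
      sum (λ r → X r (toℕ j) * identity i (site r))                        ∎
      where
      g : Fin order → Carrier
      g t = green (toℕ j) (toℕ t)
      column≈ : ∀ r → sum (λ t → κ r (toℕ t) * identity i (site r) * g t) ≈ X r (toℕ j) * identity i (site r)
      column≈ r = begin
        sum (λ t → κ r (toℕ t) * identity i (site r) * g t)
          ≈⟨ sum-cong-≋ {order} (λ t → solve 3 (λ k e g →
               k :* e :* g
               := k :* g :* e) refl (κ r (toℕ t)) _ (g t)) ⟩
        sum (λ t → κ r (toℕ t) * g t * identity i (site r))
          ≈⟨ *-distribʳ-sum {order} (identity i (site r)) (λ t → κ r (toℕ t) * g t) ⟨
        sum (λ t → κ r (toℕ t) * g t) * identity i (site r)  ≈⟨ *-congʳ (sum-κ-green r (toℕ j)) ⟩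
        X r (toℕ j) * identity i (site r)                    ∎

    α β : Carrier
    α = s * u * A
    β = s * u * B

    det-bass : det bass ≈ det₃ (entries u α β (green a a) (green last last) (green a last))
    det-bass = begin
      det bass                                                             ≈⟨ det-cong bass≈tree+K ⟩
      _                                                                    ≈⟨ det-tree-plus K ⟩
      det (λ i j → identity i j + sum (λ t → K i t * green (toℕ j) (toℕ t)))
        ≈⟨ det-cong (λ i j → +-congˡ (K-green≈ i j)) ⟩
      det (rows λ r j → X r (toℕ j))
        ≈⟨ det-three-rows (λ r j → X r (toℕ j)) ⟩
      det₃ (λ r t → δ (toℕ r) (toℕ t) + X r (toℕ (site t)))
        ≈⟨ det₃-cong (λ r t → trans (+-congˡ (reflexive (cong (X r) (toℕ-site t)))) (entry r t)) ⟩
      det₃ (entries u α β (green a a) (green last last) (green a last))                ∎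
      where
      green-a-0 : green a 0 ≈ α
      green-a-0 = trans (green-root a) W-a
      green-last-0 : green last 0 ≈ β
      green-last-0 = trans (green-root last) W-last
      green-last-a : green last a ≈ green a last
      green-last-a = green-sym last a
      entry : ∀ r t → δ (toℕ r) (toℕ t) + X r (siteℕ t) ≈ entries u α β (green a a) (green last last) (green a last) r t
      entry 0F 0F = +-congˡ (//-cong₂ (//-cong₂ refl (*-congˡ W-a)) (*-congˡ W-last))
      entry 0F 1F = +-congˡ (+-congʳ (+-congʳ (*-congˡ green-a-0)))
      entry 0F 2F = +-congˡ (+-congʳ (//-cong₂ (*-congˡ green-last-0) (*-congˡ green-last-a)))
      entry 1F 0F = +-congˡ (+-congʳ (*-congˡ W-a))
      entry 1F 1F = +-congˡ (+-congˡ (-‿cong (*-congˡ green-a-0)))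
      entry 1F 2F = +-congˡ (//-cong₂ (*-congˡ green-last-a) (*-congˡ green-last-0))
      entry 2F 0F = +-congˡ (+-congʳ (*-congˡ W-last))
      entry 2F 1F = +-congˡ (+-congˡ (-‿cong (*-congˡ green-a-0)))
      entry 2F 2F = +-congˡ (+-congˡ (-‿cong (*-congˡ green-last-0)))

    ζ⁻¹≈Φ : ζ⁻¹ graph u ≈ Φ u α β (1# - u * u * α * α) (1# - u * u * β * β) (u * u * A * B * (1# - u * u * s * s))
    ζ⁻¹≈Φ = begin
      (1# - u ^ 2) ^ (Graph.rank graph ∸ 1) * det bass
        ≡⟨ cong (λ r → (1# - u ^ 2) ^ (r ∸ 1) * det bass) (rank≡2 m> n>) ⟩
      (1# - u ^ 2) ^ 1 * det bass
        ≈⟨ *-cong (solve 1 (λ u → (:1 :- u :^ 2) :^ 1 := :1 :- u :* u) refl u) det-bass ⟩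
      (1# - u * u) * det₃ (entries u α β (green a a) (green last last) (green a last))
        ≈⟨ det-entries u α β (green a a) (green last last) (green a last) ⟩
      _ ≈⟨ Φ-cong u α β
             (trans (green-diagonal a) (+-congˡ (-‿cong (*-cong (*-congˡ W-a) W-a))))
             (trans (green-diagonal last) (+-congˡ (-‿cong (*-cong (*-congˡ W-last) W-last)))) green-a-last ⟩
      Φ u α β (1# - u * u * α * α) (1# - u * u * β * β) (u * u * A * B * (1# - u * u * s * s))  ∎

  monomial≈ : ∀ {e} i j k l → e ≡ exponent i j k l →
              s ^ i * u ^ j * (A ^ k * B ^ l) ≈ u ^ e
  monomial≈ {e} i j k l e≡ = begin
    s ^ i * u ^ j * (A ^ k * B ^ l)
      ≈⟨ *-cong (*-congʳ (^-assocʳ u p i)) (*-cong (^-assocʳ u b k) (^-assocʳ u d l)) ⟩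
    u ^ (p ℕ.* i) * u ^ j * (u ^ (b ℕ.* k) * u ^ (d ℕ.* l))
      ≈⟨ *-cong (^-homo-* u (p ℕ.* i) j) (^-homo-* u (b ℕ.* k) (d ℕ.* l)) ⟨
    u ^ (p ℕ.* i ℕ.+ j) * u ^ (b ℕ.* k ℕ.+ d ℕ.* l)
      ≈⟨ ^-homo-* u (p ℕ.* i ℕ.+ j) (b ℕ.* k ℕ.+ d ℕ.* l) ⟨
    u ^ (p ℕ.* i ℕ.+ j ℕ.+ (b ℕ.* k ℕ.+ d ℕ.* l))                         ≡⟨ cong (u ^_) e≡ ⟨
    u ^ e                                                                 ∎

  Φ-powers : Φ u (s * u * A) (s * u * B) (1# - u * u * (s * u * A) * (s * u * A)) (1# - u * u * (s * u * B) * (s * u * B))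
               (u * u * A * B * (1# - u * u * s * s))
    ≈ - (4 · u ^ (2 ℕ.* m ℕ.+ 2 ℕ.* n ∸ 2 ℕ.* p)) + u ^ (2 ℕ.* m ℕ.+ 2 ℕ.* n ∸ 4 ℕ.* p)
      + 2 · u ^ (m ℕ.+ 2 ℕ.* n ∸ 2 ℕ.* p) + 2 · u ^ (2 ℕ.* m ℕ.+ n ∸ 2 ℕ.* p)
      + u ^ (2 ℕ.* n) + u ^ (2 ℕ.* m) + 2 · u ^ (m ℕ.+ n)
      - 2 · u ^ (m ℕ.+ n ∸ 2 ℕ.* p) - 2 · u ^ n - 2 · u ^ m + 1#
  Φ-powers = trans (Φ-expanded u s A B)
    (+-congʳ (//-cong₂ (//-cong₂ (//-cong₂ (+-cong (+-cong (+-cong (+-cong (+-cong (+-cong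
      (-‿cong (×-congʳ 4 (monomial≈ 2 8 2 2 2m+2n-2p)))
      (monomial≈ 0 8 2 2 2m+2n-4p))
      (×-congʳ 2 (monomial≈ 1 6 1 2 m+2n-2p)))
      (×-congʳ 2 (monomial≈ 1 6 2 1 2m+n-2p)))
      (monomial≈ 2 4 0 2 2n))
      (monomial≈ 2 4 2 0 2m))
      (×-congʳ 2 (monomial≈ 2 4 1 1 m+n)))
      (×-congʳ 2 (monomial≈ 0 4 1 1 m+n-2p)))
      (×-congʳ 2 (monomial≈ 1 2 0 1 n≡)))
      (×-congʳ 2 (monomial≈ 1 2 1 0 m≡))))

excess : ∀ p m → (p ℕ.+ 1) ⊔ 2 < m → ∃ λ b → m ≡ suc (suc (b ℕ.+ p))
excess p m m> = m ∸ suc (suc p) , (begin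
  m
    ≡⟨ ℕ.m∸n+n≡m (subst (_< m) (ℕ.+-comm p 1) (ℕ.m⊔n<o⇒m<o (p ℕ.+ 1) 2 m>)) ⟨
  m ∸ suc (suc p) ℕ.+ suc (suc p)   ≡⟨ ℕ.+-suc _ (suc p) ⟩
  suc (m ∸ suc (suc p) ℕ.+ suc p)   ≡⟨ cong suc (ℕ.+-suc _ p) ⟩
  suc (suc (m ∸ suc (suc p) ℕ.+ p)) ∎)
  where open ≡.≡-Reasoning

mainTheorem6 : ∀ {c ℓ} (R : CommutativeRing c ℓ) →
    let open CommutativeRing R
        open Algebra.Properties.Semiring.Exp semiring using (_^_)
        open Algebra.Properties.Semiring.Mult semiring using (_×_)
        open Zeta R using (ζ⁻¹)
    in
    (u : Carrier) (p m n : ℕ) → 0 < p →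
    (m> : (p ℕ.+ 1) ⊔ 2 < m) (n> : (p ℕ.+ 1) ⊔ 2 < n) →
    ζ⁻¹ (G m n p m> n>) u
      ≈ - (4 × u ^ (2 ℕ.* m ℕ.+ 2 ℕ.* n ℕ.∸ 2 ℕ.* p))
        + u ^ (2 ℕ.* m ℕ.+ 2 ℕ.* n ℕ.∸ 4 ℕ.* p)
        + 2 × u ^ (m ℕ.+ 2 ℕ.* n ℕ.∸ 2 ℕ.* p)
        + 2 × u ^ (2 ℕ.* m ℕ.+ n ℕ.∸ 2 ℕ.* p)
        + u ^ (2 ℕ.* n)
        + u ^ (2 ℕ.* m)
        + 2 × u ^ (m ℕ.+ n)
        - 2 × u ^ (m ℕ.+ n ℕ.∸ 2 ℕ.* p)
        - 2 × u ^ n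
        - 2 × u ^ m
        + 1#
-- Matching replaces `m` and `n` by the forms b + p + 2 and d + p + 2 from which `SpanningTree`
-- builds its labels.
mainTheorem6 R u p m n 0<p m> n> with excess p m m> | excess p n n>
... | b , ≡.refl | d , ≡.refl = trans (ζ⁻¹≈Φ m> n>) Φ-powers
  where
  open CommutativeRing R using (trans)
  open ThetaDeterminant R u p b d 0<p
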